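{- For all integers $n \ge 0$, $k \ge 0$ and $r \ge 1$, $$\phi_{n+k,k}(r) = \left\{ {n+k+1 \atop n+1} \right\} \cdot \phi_n(r).$$
   Context: $\mathbb{Z}^n$ is the ring of $n$-tuples of integers with componentwise addition and multiplication. A lattice (sublattice) in $\mathbb{Z}^n$ is a $\mathbb{Z}$-submodule $L \subseteq \mathbb{Z}^n$; its co-rank is $n - \operatorname{rank}_{\mathbb{Z}} L$. A sublattice is closed under multiplication if $u \cdot v \in L$ for all $u,v \in L$ (it is not required to contain the identity $(1,\dots,1)$). For $0 \le k \le n$ and $r \ge 1$, $\phi_{n,k}(r)$ is the number of sublattices $L$ of $\mathbb{Z}^n$ such that: $L$ is closed under multiplication; $L$ has co-rank $k$ in $\mathbb{Z}^n$; and the torsion subgroup of $\mathbb{Z}^n/L$ has exactly $r$ elements. Also $\phi_n(r) = \phi_{n,0}(r)$, i.e. the number of full-rank sublattices of $\mathbb{Z}^n$ of index $r$ that are closed under multiplication. For natural numbers $u,v$, $\left\{ {u \atop v} \right\}$ is the Stirling number of the second kind: the number of partitions of a set with $u$ elements into $v$ non-empty subsets. -}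

module Defs where

open import Algebra.Bundles using (AbelianGroup; CommutativeRing)
import Algebra.Construct.Pointwise as Pointwise
import Algebra.Definitions.RawMonoid as RawMonoidDefinitions
open import Data.Fin.Base using (Fin)
open import Data.Fin.Permutation using (↔⇒≡)
open import Data.Fin.Subset using (Subset; Nonempty) renaming (_∈_ to _∈ₛ_)
open import Data.Integer.Base as ℤ using (ℤ; 0ℤ; -1ℤ)
import Data.Integer.Properties as ℤ
open import Data.Integer.Solver using (module +-*-Solver)
open import Data.Nat.Base as ℕ using (ℕ; NonZero)
open import Data.Product.Base using (Σ-syntax; ∃; ∃-syntax; _×_; _,_; proj₁)
open import Data.Vec.Functional using (Vector; _∷_)
open import Function.Bundles using (Inverse)
import Function.Properties.Inverse as Inverse
open import Level using (Level; 0ℓ; _⊔_; suc)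
open import Relation.Binary.Bundles using (Setoid)
import Relation.Binary.Construct.On as On
open import Relation.Binary.PropositionalEquality as ≡ using (_≡_; _≢_)
open import Relation.Unary using (Pred; _∈_; _≐_)
open import Relation.Unary.Properties using (≐-refl; ≐-sym; ≐-trans)

private
  variable
    a ℓ : Level

_HasCardinality_ : Setoid a ℓ → ℕ → Set (a ⊔ ℓ)
S HasCardinality N = Inverse S (≡.setoid (Fin N))

-- By this, relations of the form "S HasCardinality N" are functional in N.
HasCardinality-unique : (S : Setoid a ℓ) {M N : ℕ} →
                        S HasCardinality M → S HasCardinality N → M ≡ N
HasCardinality-unique S f g = ↔⇒≡ (Inverse.trans (Inverse.sym f) g)

module _ (G : AbelianGroup a ℓ) where
  open AbelianGroup G using (Carrier; _≈_; ε; rawMonoid; setoid)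
  open RawMonoidDefinitions rawMonoid using () renaming (_×_ to _×ᴳ_)

  HasFiniteOrder : Pred Carrier ℓ
  HasFiniteOrder x = ∃[ m ] NonZero m × m ×ᴳ x ≈ ε

  torsionSetoid : Setoid (a ⊔ ℓ) ℓ
  torsionSetoid = record
    { Carrier       = ∃ HasFiniteOrder
    ; _≈_           = λ x y → proj₁ x ≈ proj₁ y
    ; isEquivalence = On.isEquivalence proj₁ (Setoid.isEquivalence setoid)
    }

ℤ^_ : ℕ → CommutativeRing 0ℓ 0ℓ
ℤ^ n = Pointwise.commutativeRing (Fin n) ℤ.+-*-commutativeRing

infixr 7 _•_

_•_ : ∀ {n} → ℤ → Vector ℤ n → Vector ℤ n
(c • v) i = c ℤ.* v i

record Sublattice (n : ℕ) : Set₁ where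
  open CommutativeRing (ℤ^ n) using (_≈_; _+_; -_; 0#)
  field
    member   : Pred (Vector ℤ n) 0ℓ
    ∈-resp-≈ : ∀ {u v} → u ≈ v → u ∈ member → v ∈ member
    0∈       : 0# ∈ member
    +-closed : ∀ {u v} → u ∈ member → v ∈ member → u + v ∈ member
    •-closed : ∀ c {v} → v ∈ member → c • v ∈ member

  neg-closed : ∀ {v} → v ∈ member → - v ∈ member
  neg-closed {v} v∈ = ∈-resp-≈ (λ i → ℤ.-1*i≡-i (v i)) (•-closed -1ℤ v∈)

open Sublattice using (member)

IsMultiplicativelyClosed : ∀ {n} → Sublattice n → Set
IsMultiplicativelyClosed {n} L =
  ∀ {u v} → u ∈ member L → v ∈ member L → u * v ∈ member L
  where open CommutativeRing (ℤ^ n) using (_*_)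

module _ {n : ℕ} where
  open CommutativeRing (ℤ^ n) using (_≈_; 0#; +-rawMonoid)
  open RawMonoidDefinitions +-rawMonoid using (sum)

  linearCombination : ∀ {m} → Vector ℤ m → Vector (Vector ℤ n) m → Vector ℤ n
  linearCombination c b = sum (λ i → c i • b i)

  LinearlyIndependent : ∀ {m} → Vector (Vector ℤ n) m → Set
  LinearlyIndependent b =
    ∀ c → linearCombination c b ≈ 0# → ∀ i → c i ≡ 0ℤ

  LinearlyDependent : ∀ {m} → Vector (Vector ℤ n) m → Set
  LinearlyDependent b =
    ∃[ c ] linearCombination c b ≈ 0# × ∃[ i ] c i ≢ 0ℤ

  -- The rank is the size of a maximal linearly independent family in L;
  -- maximality is stated with explicit nontrivial relations.
  HasRank : Sublattice n → ℕ → Set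
  HasRank L m =
    Σ[ b ∈ Vector (Vector ℤ n) m ]
      (∀ i → b i ∈ member L) ×
      LinearlyIndependent b ×
      (∀ {v} → v ∈ member L → LinearlyDependent (v ∷ b))

  HasCorank : Sublattice n → ℕ → Set
  HasCorank L k = ∃[ m ] HasRank L m × m ℕ.+ k ≡ n

module _ {n : ℕ} (L : Sublattice n) where
  open CommutativeRing (ℤ^ n)
  open Sublattice L hiding (member)
  open +-*-Solver using (solve; _:=_; _:+_; _:-_; :-_)

  private
    infix 4 _≈/_

    _≈/_ : Vector ℤ n → Vector ℤ n → Set
    u ≈/ v = u - v ∈ member L

    ≈⇒≈/ : ∀ {u v} → u ≈ v → u ≈/ v
    ≈⇒≈/ {u} {v} u≈v =
      ∈-resp-≈ (sym (trans (+-congʳ u≈v) (-‿inverseʳ v))) 0∈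

    sym/ : ∀ {u v} → u ≈/ v → v ≈/ u
    sym/ {u} {v} u-v∈ = ∈-resp-≈ (λ i → neg-swap (u i) (v i)) (neg-closed u-v∈)
      where
      neg-swap : ∀ i j → ℤ.- (i ℤ.- j) ≡ j ℤ.- i
      neg-swap = solve 2 (λ i j → :- (i :- j) := j :- i) ≡.refl

    trans/ : ∀ {u v w} → u ≈/ v → v ≈/ w → u ≈/ w
    trans/ {u} {v} {w} u-v∈ v-w∈ = ∈-resp-≈
      (λ i → telescope (u i) (v i) (w i)) (+-closed u-v∈ v-w∈)
      where
      telescope : ∀ i j k → (i ℤ.- j) ℤ.+ (j ℤ.- k) ≡ i ℤ.- k
      telescope = solve 3 (λ i j k → (i :- j) :+ (j :- k) := i :- k) ≡.refl

    +-cong/ : ∀ {u v x y} → u ≈/ v → x ≈/ y → u + x ≈/ v + y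
    +-cong/ {u} {v} {x} {y} u-v∈ x-y∈ = ∈-resp-≈
      (λ i → exchange (u i) (v i) (x i) (y i)) (+-closed u-v∈ x-y∈)
      where
      exchange : ∀ i j k l →
                 (i ℤ.- j) ℤ.+ (k ℤ.- l) ≡ (i ℤ.+ k) ℤ.- (j ℤ.+ l)
      exchange = solve 4 (λ i j k l →
        (i :- j) :+ (k :- l) := (i :+ k) :- (j :+ l)) ≡.refl

    neg-cong/ : ∀ {u v} → u ≈/ v → - u ≈/ - v
    neg-cong/ {u} {v} u-v∈ = ∈-resp-≈
      (λ i → ℤ.neg-distrib-+ (u i) (ℤ.- v i)) (neg-closed u-v∈)

  quotientGroup : AbelianGroup 0ℓ 0ℓ
  quotientGroup = record
    { Carrier = Vector ℤ n
    ; _≈_     = _≈/_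
    ; _∙_     = _+_
    ; ε       = 0#
    ; _⁻¹     = -_
    ; isAbelianGroup = record
      { isGroup = record
        { isMonoid = record
          { isSemigroup = record
            { isMagma = record
              { isEquivalence = record
                { refl  = λ {u} → ≈⇒≈/ {u} refl
                ; sym   = λ {u} {v} → sym/ {u} {v}
                ; trans = λ {u} {v} {w} → trans/ {u} {v} {w}
                }
              ; ∙-cong = λ {u} {v} {x} {y} → +-cong/ {u} {v} {x} {y}
              }
            ; assoc = λ u v w → ≈⇒≈/ (+-assoc u v w)
            }
          ; identity = (λ u → ≈⇒≈/ (+-identityˡ u))
                     , (λ u → ≈⇒≈/ (+-identityʳ u))
          }
        ; inverse = (λ u → ≈⇒≈/ (-‿inverseˡ u))
                  , (λ u → ≈⇒≈/ (-‿inverseʳ u))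
        ; ⁻¹-cong = λ {u} {v} → neg-cong/ {u} {v}
        }
      ; comm = λ u v → ≈⇒≈/ (+-comm u v)
      }
    }

record MultiplicativeSublattice (n k r : ℕ) : Set₁ where
  field
    sublattice  : Sublattice n
    *-closed    : IsMultiplicativelyClosed sublattice
    corank      : HasCorank sublattice k
    torsionCard : torsionSetoid (quotientGroup sublattice) HasCardinality r

-- Two sublattices are the same when they have the same elements; the
-- evidence for the remaining fields is not compared.
multiplicativeSublattices : (n k r : ℕ) → Setoid (suc 0ℓ) 0ℓ
multiplicativeSublattices n k r = record
  { Carrier       = MultiplicativeSublattice n k r
  ; _≈_           = λ L M → elements L ≐ elements M
  ; isEquivalence = record
    { refl = ≐-refl ; sym = ≐-sym ; trans = ≐-trans }
  }
  where
  elements : MultiplicativeSublattice n k r → Pred (Vector ℤ n) 0ℓ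
  elements L = member (MultiplicativeSublattice.sublattice L)

-- IsPhi n k r N reads φₙ,ₖ(r) = N.
IsPhi : (n k r N : ℕ) → Set₁
IsPhi n k r N = multiplicativeSublattices n k r HasCardinality N

record Partition (u v : ℕ) : Set where
  field
    block    : Fin v → Subset u
    nonempty : ∀ i → Nonempty (block i)
    disjoint : ∀ {i j x} → x ∈ₛ block i → x ∈ₛ block j → i ≡ j
    cover    : ∀ x → ∃[ i ] x ∈ₛ block i

  IsBlock : Pred (Subset u) 0ℓ
  IsBlock B = ∃[ i ] block i ≡ B

-- The indexing of the blocks is immaterial: partitions are compared by
-- their sets of blocks.
partitions : (u v : ℕ) → Setoid 0ℓ 0ℓ
partitions u v = record
  { Carrier       = Partition u v
  ; _≈_           = λ P Q → Partition.IsBlock P ≐ Partition.IsBlock Q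
  ; isEquivalence = record
    { refl = ≐-refl ; sym = ≐-sym ; trans = ≐-trans }
  }

-- IsStirling u v N reads { u over v } = N.
IsStirling : (u v N : ℕ) → Set
IsStirling u v N = partitions u v HasCardinality N

{-# OPTIONS --safe #-}
module Submission where

-- Let L be a multiplicatively closed sublattice of ℤ^(n+k), and call two
-- coordinates equivalent when they agree on all of L; the coordinates vanishing
-- on L are joined to an extra base point. If v is the number of the other classes,
-- L lies in the copy of ℤ^v of the vectors constant on classes and zero on the base
-- class. Products of elements of L that separate classes give a nonzero multiple of
-- each class indicator, so v is the rank n and L has finite index in that copy,
-- which is saturated and therefore contains all torsion modulo L. Hence L amounts
-- to a partition of n+k+1 points into n+1 blocks together with a full-rank
-- multiplicative sublattice of ℤ^n of index r. The latter are finite in number: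
-- each contains r! ℤ^n, so it is a union of residue classes modulo r!.

open import Data.Nat.Base using (ℕ; _+_; _*_; _≥_)
open import Data.Product.Base using (∃-syntax; _×_)
open import Relation.Binary.PropositionalEquality using (_≡_)
open import Defs
open import Algebra.Bundles using (AbelianGroup)
import Algebra.Definitions.RawMonoid as RawMonoidDefinitions
import Data.Integer.Properties as ℤ
open import Algebra.Properties.Semiring.Sum ℤ.+-*-semiring
  using (sum; sum-cong-≗; ∑-distrib-+; ∑-comm; *-distribˡ-sum; *-distribʳ-sum)
open import Data.Fin.Base using (Fin; zero; suc; toℕ; fromℕ<; punchIn; punchOut; finToFun; funToFin)
open import Data.Fin.Patterns using (1F)
open import Data.Fin.Permutation using (↔⇒≡)
import Data.Fin.Properties as Fin
open import Data.Fin.Subset using (Subset) renaming (_∈_ to _∈ₛ_)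
open import Data.Fin.Subset.Properties using (⊆-antisym)
open import Data.Integer.Base as ℤ using (ℤ; 0ℤ; 1ℤ)
import Data.Integer.DivMod as ℤ
open import Data.Integer.Divisibility.Signed as ℤ∣ using (_∣_; divides; _∣?_)
open import Data.Integer.Solver using (module +-*-Solver)
open import Data.Maybe.Base using (Maybe; just; nothing)
open import Data.Nat.Base as ℕ using (zero; suc; NonZero; _^_; _∸_; _!)
import Data.Nat.Divisibility as ℕ∣
import Data.Nat.Properties as ℕ
open import Data.Product.Base using (Σ-syntax; ∃; _,_; proj₁; proj₂)
open import Data.Product.Function.NonDependent.Propositional using (_×-↔_)
open import Data.Product.Function.NonDependent.Setoid using (_×-inverse_)
open import Data.Product.Relation.Binary.Pointwise.NonDependent using (_×ₛ_; Pointwise-≡↔≡)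
open import Data.Sum.Base using (_⊎_; inj₁; inj₂)
open import Data.Sum.Function.Propositional using (_⊎-↔_)
import Data.Vec.Base as Vec
open import Data.Vec.Functional using (Vector; _∷_)
import Data.Vec.Properties as Vec
open import Function.Base using (_∘_; id)
open import Function.Bundles using (Inverse; Injection; _↔_; mk↔ₛ′)
import Function.Properties.Inverse as Inverseₚ
open import Level using (Level; 0ℓ; _⊔_)
open import Relation.Binary.Bundles using (Setoid)
open import Relation.Binary.Definitions using (DecidableEquality) renaming (Decidable to Decidable₂)
open import Relation.Binary.PropositionalEquality as ≡
  using (_≢_; _≗_; refl; sym; trans; cong; cong₂; subst; subst₂; module ≡-Reasoning)
open import Relation.Nullary using (Dec; yes; no; does; ¬_; ¬?; contradiction)
open import Relation.Nullary.Decidable using (dec-true; decidable-stable; map′; _→-dec_; _×-dec_)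
open import Relation.Unary using (Pred; Decidable; _≐_; _∈_)

open Sublattice using (member; ∈-resp-≈; 0∈; +-closed; •-closed; neg-closed)
open MultiplicativeSublattice using (sublattice; *-closed; corank; torsionCard)

-- Linear relations over ℤ

-- `HasCardinality` asks for an actual bijection with `Fin N`, while `member` is an arbitrary
-- predicate, so every count has to be made effective from the data that a sublattice carries.
-- Agreement of two coordinates on all of L is read off a maximal independent family, which is
-- finite. Membership in a full-rank L is decidable because the given bijection with `Fin r` already
-- tells all cosets apart. The period is r! rather than r because the pigeonhole principle yields,
-- for each x, some d between 1 and r with d x in L; r! is a multiple of every such d, and
-- Lagrange's theorem is avoided. Whether a union of residue classes has index r is settled by
-- counting its quotient and comparing.

linearCombination-apply : ∀ {n m} (c : Vector ℤ m) (b : Vector (Vector ℤ n) m) j →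
                          linearCombination c b j ≡ sum (λ i → c i ℤ.* b i j)
linearCombination-apply {m = zero}  c b j = refl
linearCombination-apply {m = suc m} c b j =
  cong (ℤ._+_ (c zero ℤ.* b zero j)) (linearCombination-apply (c ∘ suc) (b ∘ suc) j)

sum-zero : ∀ {m} {f : Vector ℤ m} → (∀ i → f i ≡ 0ℤ) → sum f ≡ 0ℤ
sum-zero {zero}  f≡0 = refl
sum-zero {suc m} f≡0 = cong₂ ℤ._+_ (f≡0 zero) (sum-zero (f≡0 ∘ suc))

*-≢0 : ∀ {i j} → i ≢ 0ℤ → j ≢ 0ℤ → i ℤ.* j ≢ 0ℤ
*-≢0 {i} i≢0 j≢0 ij≡0 with ℤ.i*j≡0⇒i≡0∨j≡0 i ij≡0
... | inj₁ i≡0 = i≢0 i≡0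
... | inj₂ j≡0 = j≢0 j≡0

*-cancelˡ : ∀ {d i j} → d ≢ 0ℤ → d ℤ.* i ≡ d ℤ.* j → i ≡ j
*-cancelˡ {d} {i} {j} d≢0 = ℤ.*-cancelˡ-≡ d i j {{ℤ.≢-nonZero d≢0}}

δ : ∀ {n} → Fin n → Vector ℤ n
δ zero    zero    = 1ℤ
δ zero    (suc j) = 0ℤ
δ (suc i) zero    = 0ℤ
δ (suc i) (suc j) = δ i j

δ-diag : ∀ {n} (i : Fin n) → δ i i ≡ 1ℤ
δ-diag zero    = refl
δ-diag (suc i) = δ-diag i

δ-off : ∀ {n} {i j : Fin n} → i ≢ j → δ i j ≡ 0ℤ
δ-off {i = zero}  {zero}  i≢j = contradiction refl i≢j
δ-off {i = zero}  {suc j} i≢j = refl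
δ-off {i = suc i} {zero}  i≢j = refl
δ-off {i = suc i} {suc j} i≢j = δ-off (i≢j ∘ cong suc)

sum-*δ : ∀ {n} (f : Vector ℤ n) (j : Fin n) → sum (λ i → f i ℤ.* δ i j) ≡ f j
sum-*δ f zero    = trans
  (cong₂ ℤ._+_ (ℤ.*-identityʳ (f zero)) (sum-zero (λ i → ℤ.*-zeroʳ (f (suc i)))))
  (ℤ.+-identityʳ (f zero))
sum-*δ f (suc j) = trans
  (cong₂ ℤ._+_ (ℤ.*-zeroʳ (f zero)) (sum-*δ (f ∘ suc) j))
  (ℤ.+-identityˡ (f (suc j)))

-- Fraction-free elimination of the coordinate c with pivot a zero c.
exists-relation : ∀ {m w} → m ℕ.< w → (a : Fin w → Vector ℤ m) →
                  Σ[ t ∈ Vector ℤ w ]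
                    (∀ j → sum (λ i → t i ℤ.* a i j) ≡ 0ℤ) × ∃[ i ] t i ≢ 0ℤ
exists-relation {zero}  {suc w} _ a = (λ _ → 1ℤ) , (λ ()) , zero , λ ()
exists-relation {suc m} {suc w} (ℕ.s≤s m<w) a
  with Fin.any? (λ c → ¬? (a zero c ℤ.≟ 0ℤ))
... | no ∄c = δ zero , relation , zero , λ ()
  where
  relation : ∀ j → sum (λ i → δ zero i ℤ.* a i j) ≡ 0ℤ
  relation j with a zero j ℤ.≟ 0ℤ
  ... | yes a≡0 = cong₂ ℤ._+_ (trans (ℤ.*-identityˡ _) a≡0)
                    (sum-zero (λ i → ℤ.*-zeroˡ (a (suc i) j)))
  ... | no  a≢0 = contradiction (j , a≢0) ∄c
... | yes (c , p≢0)
  with exists-relation m<w (λ i j → a zero c ℤ.* a (suc i) (punchIn c j)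
                                    ℤ.- a (suc i) c ℤ.* a zero (punchIn c j))
... | t , t-rel , k , tₖ≢0 =
  ℤ.- s ∷ (λ i → p ℤ.* t i) , relation , suc k , *-≢0 p≢0 tₖ≢0
  where
  p = a zero c
  s = sum (λ i → t i ℤ.* a (suc i) c)

  -- The recursive relation covers every coordinate except c; at c each reduced row cancels
  -- identically.
  eliminated : ∀ j → sum (λ i → t i ℤ.* (p ℤ.* a (suc i) j ℤ.- a (suc i) c ℤ.* a zero j)) ≡ 0ℤ
  eliminated j with c Fin.≟ j
  ... | yes refl = sum-zero (λ i → lemma (t i) p (a (suc i) c))
    where
    open +-*-Solver
    lemma : ∀ t p x → t ℤ.* (p ℤ.* x ℤ.- x ℤ.* p) ≡ 0ℤ
    lemma = solve 3 (λ t p x → t :* (p :* x :- x :* p) := con 0ℤ) refl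
  ... | no c≢j = subst
    (λ j → sum (λ i → t i ℤ.* (p ℤ.* a (suc i) j ℤ.- a (suc i) c ℤ.* a zero j)) ≡ 0ℤ)
    (Fin.punchIn-punchOut c≢j) (t-rel (punchOut c≢j))

  relation : ∀ j → ℤ.- s ℤ.* a zero j ℤ.+ sum (λ i → (p ℤ.* t i) ℤ.* a (suc i) j) ≡ 0ℤ
  relation j = begin
    ℤ.- s ℤ.* a zero j ℤ.+ sum (λ i → (p ℤ.* t i) ℤ.* a (suc i) j)
      ≡⟨ cong (ℤ._+ sum (λ i → (p ℤ.* t i) ℤ.* a (suc i) j)) (begin
           ℤ.- s ℤ.* a zero j            ≡⟨ neg-swap s (a zero j) ⟩
           s ℤ.* ℤ.- a zero j            ≡⟨ *-distribʳ-sum (ℤ.- a zero j) (λ i → t i ℤ.* a (suc i) c) ⟩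
           sum (λ i → (t i ℤ.* a (suc i) c) ℤ.* ℤ.- a zero j) ∎) ⟩
    sum (λ i → (t i ℤ.* a (suc i) c) ℤ.* ℤ.- a zero j) ℤ.+ sum (λ i → (p ℤ.* t i) ℤ.* a (suc i) j)
      ≡⟨ ∑-distrib-+ (λ i → (t i ℤ.* a (suc i) c) ℤ.* ℤ.- a zero j) (λ i → (p ℤ.* t i) ℤ.* a (suc i) j) ⟨
    sum (λ i → (t i ℤ.* a (suc i) c) ℤ.* ℤ.- a zero j ℤ.+ (p ℤ.* t i) ℤ.* a (suc i) j)
      ≡⟨ sum-cong-≗ (λ i → collect (t i) (a (suc i) c) (a zero j) p (a (suc i) j)) ⟩
    sum (λ i → t i ℤ.* (p ℤ.* a (suc i) j ℤ.- a (suc i) c ℤ.* a zero j))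
      ≡⟨ eliminated j ⟩
    0ℤ ∎
    where
    open ≡-Reasoning
    open +-*-Solver
    neg-swap : ∀ s x → ℤ.- s ℤ.* x ≡ s ℤ.* ℤ.- x
    neg-swap = solve 2 (λ s x → :- s :* x := s :* :- x) refl
    collect : ∀ t x y p z → (t ℤ.* x) ℤ.* ℤ.- y ℤ.+ (p ℤ.* t) ℤ.* z ≡ t ℤ.* (p ℤ.* z ℤ.- x ℤ.* y)
    collect = solve 5 (λ t x y p z → (t :* x) :* :- y :+ (p :* t) :* z := t :* (p :* z :- x :* y)) refl

-- Counting a setoid from a finite covering list

module _ {a ℓ : Level} (S : Setoid a ℓ) (_≟_ : Decidable₂ (Setoid._≈_ S)) where
  open Setoid S renaming (refl to ≈-refl; sym to ≈-sym; trans to ≈-trans)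

  -- `nothing` marks a candidate that yields no element, as happens for sets of residues that form
  -- no lattice of the right index. An entry is kept only if no later kept entry equals it, so each
  -- value is represented exactly once.
  without-repetition : ∀ {N} (f : Fin N → Maybe Carrier) →
    ∃[ M ] Σ[ g ∈ (Fin M → Carrier) ]
      (∀ i j → g i ≈ g j → i ≡ j) ×
      (∀ k {x} → f k ≡ just x → ∃[ i ] x ≈ g i)
  without-repetition {zero} f = 0 , (λ ()) , (λ ()) , λ ()
  without-repetition {suc N} f with f zero in f0 | without-repetition (f ∘ suc)
  ... | nothing | M , g , g-inj , g-hits = M , g , g-inj , hits
    where
    hits : ∀ k {x} → f k ≡ just x → ∃[ i ] x ≈ g i
    hits zero    fk with () ← trans (sym f0) fk
    hits (suc k) fk = g-hits k fk
  ... | just y | M , g , g-inj , g-hits with Fin.any? (λ i → y ≟ g i)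
  ... | yes y≈ = M , g , g-inj , hits
    where
    hits : ∀ k {x} → f k ≡ just x → ∃[ i ] x ≈ g i
    hits zero    fk with refl ← trans (sym f0) fk = y≈
    hits (suc k) fk = g-hits k fk
  ... | no y≉ = suc M , y ∷ g , inj , hits
    where
    inj : ∀ i j → (y ∷ g) i ≈ (y ∷ g) j → i ≡ j
    inj zero    zero    eq = refl
    inj zero    (suc j) eq = contradiction (j , eq) y≉
    inj (suc i) zero    eq = contradiction (i , ≈-sym eq) y≉
    inj (suc i) (suc j) eq = cong suc (g-inj i j eq)
    hits : ∀ k {x} → f k ≡ just x → ∃[ i ] x ≈ (y ∷ g) i
    hits zero    fk with refl ← trans (sym f0) fk = zero , ≈-refl
    hits (suc k) fk with i , x≈ ← g-hits k fk = suc i , x≈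

  finite⇒cardinality : ∀ {N} (f : Fin N → Maybe Carrier) →
                       (∀ x → ∃[ k ] ∃[ y ] f k ≡ just y × x ≈ y) →
                       ∃[ M ] S HasCardinality M
  finite⇒cardinality f covers with without-repetition f
  ... | M , g , g-inj , g-hits = M , record
    { to = λ x → proj₁ (position x)
    ; from = g
    ; to-cong = λ {x} {y} x≈y → g-inj _ _
        (≈-trans (≈-sym (proj₂ (position x))) (≈-trans x≈y (proj₂ (position y))))
    ; from-cong = λ { refl → ≈-refl }
    ; inverse = (λ {i} {x} x≈gi → g-inj _ _ (≈-trans (≈-sym (proj₂ (position x))) x≈gi))
              , λ { {x} refl → ≈-sym (proj₂ (position x)) }
    }
    where
    position : ∀ x → ∃[ i ] x ≈ g i
    position x with k , y , fk , x≈y ← covers x with i , y≈gi ← g-hits k fk = i , ≈-trans x≈y y≈gi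

-- Canonical set partitions

-- A growth g : Growth u v encodes a partition of Fin (suc u) into suc v blocks:
-- each point other than the base point zero either founds a new block or joins
-- an old one. The encoding is canonical, so partitions need no quotient.
data Growth : ℕ → ℕ → Set where
  start : Growth 0 0
  new   : ∀ {u v} → Growth u v → Growth (suc u) (suc v)
  old   : ∀ {u v} → Fin (suc v) → Growth u v → Growth (suc u) v

-- The newest point is 1, since 0 is the base point and stays in block 0. When it founds a block,
-- that block is numbered 1, and `punchIn 1F` renumbers the earlier points and blocks around it.
label : ∀ {u v} → Growth u v → Fin (suc u) → Fin (suc v)
label g         zero          = zero
label (new g)   (suc zero)    = suc zero
label (new g)   (suc (suc i)) = punchIn (suc zero) (label g (suc i))
label (old b g) (suc zero)    = b
label (old b g) (suc (suc i)) = label g (suc i)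

label-new : ∀ {u v} (g : Growth u v) x → label (new g) (punchIn 1F x) ≡ punchIn 1F (label g x)
label-new g zero    = refl
label-new g (suc x) = refl

label-old : ∀ {u v} b (g : Growth u v) x → label (old b g) (punchIn 1F x) ≡ label g x
label-old b g zero    = refl
label-old b g (suc x) = refl

label-surjective : ∀ {u v} (g : Growth u v) i → ∃[ x ] label g x ≡ i
label-surjective start zero = zero , refl
label-surjective (new g) zero = zero , refl
label-surjective (new g) (suc zero) = 1F , refl
label-surjective (new g) (suc (suc i)) with x , eq ← label-surjective g (suc i) =
  punchIn 1F x , trans (label-new g x) (cong (punchIn 1F) eq)
label-surjective (old b g) i with x , eq ← label-surjective g i =
  punchIn 1F x , trans (label-old b g x) eq

-- Names of blocks are irrelevant: two labellings describe one partition precisely when they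
-- identify the same pairs. Comparing kernels avoids choosing a renaming.
SameKernel : ∀ {a b c} {A : Set a} {B : Set b} {C : Set c} → (A → B) → (A → C) → Set (a ⊔ b ⊔ c)
SameKernel f g = ∀ x y → (f x ≡ f y → g x ≡ g y) × (g x ≡ g y → f x ≡ f y)

sameKernel : ∀ {a b c} {A : Set a} {B : Set b} {C : Set c} {f : A → B} {g : A → C} (h : B → C) →
             (∀ i j → h i ≡ h j → i ≡ j) → (∀ x → h (f x) ≡ g x) → SameKernel f g
sameKernel h h-inj h∘f≗g x y =
    (λ eq → trans (sym (h∘f≗g x)) (trans (cong h eq) (h∘f≗g y)))
  , (λ eq → h-inj _ _ (trans (h∘f≗g x) (trans eq (sym (h∘f≗g y)))))

SameKernel-sym : ∀ {a b c} {A : Set a} {B : Set b} {C : Set c} {f : A → B} {g : A → C} →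
                 SameKernel f g → SameKernel g f
SameKernel-sym f~g x y = proj₂ (f~g x y) , proj₁ (f~g x y)

SameKernel-trans : ∀ {a b c d} {A : Set a} {B : Set b} {C : Set c} {D : Set d} {f : A → B} {g : A → C} {h : A → D} →
                   SameKernel f g → SameKernel g h → SameKernel f h
SameKernel-trans f~g g~h x y = proj₁ (g~h x y) ∘ proj₁ (f~g x y) , proj₂ (f~g x y) ∘ proj₂ (g~h x y)

label-new-kernel : ∀ {u v} (g : Growth u v) → SameKernel (label g) (label (new g) ∘ punchIn 1F)
label-new-kernel g = sameKernel (punchIn 1F) (Fin.punchIn-injective 1F) (λ x → sym (label-new g x))

label-old-kernel : ∀ {u v} b (g : Growth u v) → SameKernel (label g) (label (old b g) ∘ punchIn 1F)
label-old-kernel b g = sameKernel id (λ _ _ eq → eq) (λ x → sym (label-old b g x))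

-- Whether point 1 shares its block with another point separates `new` from `old`, and induction
-- applies to the remaining points. For `old b` and `old c`, a point of block b shows that b = c, as
-- both growths place it together with point 1.
Growth-unique : ∀ {u v} (g h : Growth u v) → SameKernel (label g) (label h) → g ≡ h
Growth-unique start start same = refl
Growth-unique (new g) (new h) same = cong new (Growth-unique g h
  (SameKernel-trans (label-new-kernel g)
    (SameKernel-trans (λ x y → same (punchIn 1F x) (punchIn 1F y)) (SameKernel-sym (label-new-kernel h)))))
Growth-unique (new g) (old b h) same with x , eq ← label-surjective h b =
  contradiction (trans (sym (label-new g x)) (proj₂ (same (punchIn 1F x) 1F) (trans (label-old b h x) eq)))
    (Fin.punchInᵢ≢i 1F (label g x))
Growth-unique (old b g) (new h) same with x , eq ← label-surjective g b =
  contradiction (trans (sym (label-new h x)) (proj₁ (same (punchIn 1F x) 1F) (trans (label-old b g x) eq)))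
    (Fin.punchInᵢ≢i 1F (label h x))
Growth-unique (old b g) (old c h) same with Growth-unique g h
  (SameKernel-trans (label-old-kernel b g)
    (SameKernel-trans (λ x y → same (punchIn 1F x) (punchIn 1F y)) (SameKernel-sym (label-old-kernel c h))))
... | refl with x , eq ← label-surjective g b = cong (λ b → old b g)
  (trans (sym eq) (trans (sym (label-old c g x)) (proj₁ (same (punchIn 1F x) 1F) (trans (label-old b g x) eq))))

-- The image factorisation of f through the labelling by its own fibres.
classify : ∀ {a} {D : Set a} → DecidableEquality D → ∀ {u} (f : Fin (suc u) → D) →
           ∃[ v ] Σ[ g ∈ Growth u v ] Σ[ h ∈ (Fin (suc v) → D) ]
             (∀ i j → h i ≡ h j → i ≡ j) × (∀ x → h (label g x) ≡ f x)
classify _≟_ {zero} f = 0 , start , (λ _ → f zero) , (λ { zero zero _ → refl }) , λ { zero → refl }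
classify {D = D} _≟_ {suc u} f with classify _≟_ (f ∘ punchIn 1F)
... | v , g , h , h-inj , h-label with Fin.any? (λ i → h i ≟ f 1F)
... | yes (b , hb) = v , old b g , h , h-inj , eqs
  where
  eqs : ∀ x → h (label (old b g) x) ≡ f x
  eqs zero = h-label zero
  eqs (suc zero) = hb
  eqs (suc (suc x)) = h-label (suc x)
... | no ∄b = suc v , (new g , (h′ , (h′-inj , eqs)))
  where
  h′ : Fin (suc (suc v)) → D
  h′ zero = h zero
  h′ (suc zero) = f 1F
  h′ (suc (suc i)) = h (suc i)

  h′-punchIn : ∀ i → h′ (punchIn 1F i) ≡ h i
  h′-punchIn zero    = refl
  h′-punchIn (suc i) = refl

  h′-inj : ∀ i j → h′ i ≡ h′ j → i ≡ j
  h′-inj zero zero eq = refl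
  h′-inj zero (suc zero) eq = contradiction (zero , eq) ∄b
  h′-inj zero (suc (suc j)) eq with () ← h-inj _ _ eq
  h′-inj (suc zero) zero eq = contradiction (zero , sym eq) ∄b
  h′-inj (suc zero) (suc zero) eq = refl
  h′-inj (suc zero) (suc (suc j)) eq = contradiction (suc j , sym eq) ∄b
  h′-inj (suc (suc i)) zero eq with () ← h-inj _ _ eq
  h′-inj (suc (suc i)) (suc zero) eq = contradiction (suc i , eq) ∄b
  h′-inj (suc (suc i)) (suc (suc j)) eq = cong suc (h-inj _ _ eq)

  eqs : ∀ x → h′ (label (new g) x) ≡ f x
  eqs zero = h-label zero
  eqs (suc zero) = refl
  eqs (suc (suc x)) = trans (h′-punchIn (label g (suc x))) (h-label (suc x))

-- The recurrence of the Stirling numbers: the newest point founds a block or joins one of the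
-- blocks already present.
Growth-suc : ∀ {u v} → Growth (suc u) (suc v) ↔ (Growth u v ⊎ (Fin (suc (suc v)) × Growth u (suc v)))
Growth-suc = mk↔ₛ′
  (λ { (new g) → inj₁ g ; (old b g) → inj₂ (b , g) })
  (λ { (inj₁ g) → new g ; (inj₂ (b , g)) → old b g })
  (λ { (inj₁ g) → refl ; (inj₂ (b , g)) → refl })
  (λ { (new g) → refl ; (old b g) → refl })

Growth-cardinality : ∀ u v → ∃[ N ] ≡.setoid (Growth u v) HasCardinality N
Growth-cardinality zero zero = 1 , mk↔ₛ′
  (λ _ → zero) (λ _ → start) (λ { zero → refl }) (λ { start → refl })
Growth-cardinality zero (suc v) = 0 , mk↔ₛ′ (λ ()) (λ ()) (λ ()) (λ ())
Growth-cardinality (suc u) zero with N , f ← Growth-cardinality u zero = N , mk↔ₛ′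
  (λ { (old zero g) → Inverse.to f g }) (old zero ∘ Inverse.from f)
  (Inverse.strictlyInverseˡ f) (λ { (old zero g) → cong (old zero) (Inverse.strictlyInverseʳ f g) })
Growth-cardinality (suc u) (suc v)
  with M , f ← Growth-cardinality u v | N , g ← Growth-cardinality u (suc v) =
  M + suc (suc v) * N ,
  Inverseₚ.↔-trans Growth-suc (Inverseₚ.↔-trans
    (f ⊎-↔ Inverseₚ.↔-trans (Inverseₚ.↔-refl ×-↔ g) (Inverseₚ.↔-sym Fin.*↔×))
    (Inverseₚ.↔-sym Fin.+↔⊎))

-- Set partitions and their kernels

module _ {u v : ℕ} where
  open Partition

  blockOf : Partition u v → Fin u → Fin v
  blockOf P x = proj₁ (cover P x)

  ∈-blockOf : ∀ P {x i} → x ∈ₛ block P i → blockOf P x ≡ i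
  ∈-blockOf P {x} x∈ = disjoint P (proj₂ (cover P x)) x∈

  blockOf-surjective : ∀ P i → ∃[ x ] blockOf P x ≡ i
  blockOf-surjective P i with x , x∈ ← nonempty P i = x , ∈-blockOf P x∈

  ≈-blockOf : ∀ P {x y} → blockOf P x ≡ blockOf P y → y ∈ₛ block P (blockOf P x)
  ≈-blockOf P {y = y} eq = subst (λ i → y ∈ₛ block P i) (sym eq) (proj₂ (cover P y))

  sameBlocks⇒sameKernel : ∀ P Q → IsBlock P ≐ IsBlock Q → SameKernel (blockOf P) (blockOf Q)
  sameBlocks⇒sameKernel P Q (P⊆Q , Q⊆P) x y = transfer P Q P⊆Q , transfer Q P Q⊆P
    where
    transfer : ∀ P Q → (∀ {B} → IsBlock P B → IsBlock Q B) → blockOf P x ≡ blockOf P y → blockOf Q x ≡ blockOf Q y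
    transfer P Q P⊆Q eq with i , eqB ← P⊆Q (blockOf P x , refl) = trans
      (∈-blockOf Q (subst (x ∈ₛ_) (sym eqB) (proj₂ (cover P x))))
      (sym (∈-blockOf Q (subst (y ∈ₛ_) (sym eqB) (≈-blockOf P eq))))

  sameKernel⇒sameBlocks : ∀ P Q → SameKernel (blockOf P) (blockOf Q) → IsBlock P ≐ IsBlock Q
  sameKernel⇒sameBlocks P Q same = transfer P Q same , transfer Q P (SameKernel-sym same)
    where
    transfer : ∀ P Q → SameKernel (blockOf P) (blockOf Q) → ∀ {B} → IsBlock P B → IsBlock Q B
    transfer P Q same (i , refl) with x , refl ← blockOf-surjective P i = blockOf Q x , ⊆-antisym
      (λ {y} y∈ → ≈-blockOf P (proj₂ (same x y) (sym (∈-blockOf Q y∈))))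
      (λ {y} y∈ → ≈-blockOf Q (proj₁ (same x y) (sym (∈-blockOf P y∈))))

fibres : ∀ {u v} (f : Fin u → Fin v) → (∀ i → ∃[ x ] f x ≡ i) → Partition u v
fibres {u} {v} f f-surj = record
  { block    = fibre
  ; nonempty = λ i → proj₁ (f-surj i) , fibre⁺ (proj₂ (f-surj i))
  ; disjoint = λ x∈ y∈ → trans (sym (fibre⁻ x∈)) (fibre⁻ y∈)
  ; cover    = λ x → f x , fibre⁺ refl
  }
  where
  fibre : Fin v → Subset u
  fibre i = Vec.tabulate (λ x → does (f x Fin.≟ i))
  fibre⁺ : ∀ {x i} → f x ≡ i → x ∈ₛ fibre i
  fibre⁺ {x} {i} eq = Vec.lookup⇒[]= x _ (trans (Vec.lookup∘tabulate _ x) (dec-true (f x Fin.≟ i) eq))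
  fibre⁻ : ∀ {x i} → x ∈ₛ fibre i → f x ≡ i
  fibre⁻ {x} {i} x∈
    with f x Fin.≟ i
       | trans (sym (Vec.lookup∘tabulate (λ x → does (f x Fin.≟ i)) x)) (Vec.[]=⇒lookup x∈)
  ... | yes eq | _ = eq

module _ {u v : ℕ} where
  open Partition

  growth : (P : Partition (suc u) (suc v)) → Σ[ g ∈ Growth u v ] SameKernel (label g) (blockOf P)
  growth P with w , g , h , h-inj , h-label ← classify Fin._≟_ (blockOf P)
    -- `classify` leaves the number of blocks open. Here `h` is also surjective, because every block
    -- of P is nonempty, so the bijection forces w = v.
    with refl ← ℕ.suc-injective (↔⇒≡ {suc w} {suc v} (mk↔ₛ′ h
      (λ i → label g (proj₁ (blockOf-surjective P i)))
      (λ i → trans (h-label _) (proj₂ (blockOf-surjective P i)))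
      (λ i → h-inj _ _ (trans (h-label _) (proj₂ (blockOf-surjective P (h i)))))))
    = g , sameKernel h h-inj h-label

  fibresOf : Growth u v → Partition (suc u) (suc v)
  fibresOf g = fibres (label g) (label-surjective g)

  partitions-Growth : Inverse (partitions (suc u) (suc v)) (≡.setoid (Growth u v))
  partitions-Growth = record
    { to = λ P → proj₁ (growth P)
    ; from = fibresOf
    ; to-cong = λ {P} {Q} → to-cong P Q
    ; from-cong = λ { {g} refl → id , id }
    ; inverse = (λ {g} {P} P≈g → Growth-unique _ _ (SameKernel-trans (proj₂ (growth P))
                  (sameBlocks⇒sameKernel P (fibresOf g) P≈g)))
              , λ { {P} refl → sameKernel⇒sameBlocks (fibresOf (proj₁ (growth P))) P (proj₂ (growth P)) }
    }
    where
    to-cong : ∀ P Q → IsBlock P ≐ IsBlock Q → proj₁ (growth P) ≡ proj₁ (growth Q)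
    to-cong P Q P≈Q = Growth-unique _ _ (SameKernel-trans (proj₂ (growth P))
      (SameKernel-trans (sameBlocks⇒sameKernel P Q P≈Q) (SameKernel-sym (proj₂ (growth Q)))))

-- Vectors constant on the blocks of a partition

-‿closed : ∀ {n} (L : Sublattice n) {x y} → x ∈ member L → y ∈ member L → (λ i → x i ℤ.- y i) ∈ member L
-‿closed L x∈ y∈ = +-closed L x∈ (neg-closed L y∈)

module _ {n : ℕ} (L : Sublattice n) where
  open AbelianGroup (quotientGroup L) using (rawMonoid)
  open RawMonoidDefinitions rawMonoid using () renaming (_×_ to _×ᴳ_)

  ×-apply : ∀ m x i → (m ×ᴳ x) i ≡ ℤ.+ m ℤ.* x i
  ×-apply zero    x i = sym (ℤ.*-zeroˡ (x i))
  ×-apply (suc m) x i = trans (cong (ℤ._+_ (x i)) (×-apply m x i)) (sym (ℤ.suc-* (ℤ.+ m) (x i)))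

  -- Equality with zero in the quotient unfolds to membership of a difference, hence the subtracted
  -- 0.
  order⇒multiple : ∀ {m x} → (λ i → (m ×ᴳ x) i ℤ.- 0ℤ) ∈ member L → (ℤ.+ m • x) ∈ member L
  order⇒multiple {m} {x} = ∈-resp-≈ L λ i → trans (ℤ.+-identityʳ _) (×-apply m x i)

  multiple⇒order : ∀ {m x} → (ℤ.+ m • x) ∈ member L → (λ i → (m ×ᴳ x) i ℤ.- 0ℤ) ∈ member L
  multiple⇒order {m} {x} = ∈-resp-≈ L λ i → sym (trans (ℤ.+-identityʳ _) (×-apply m x i))

-- The extra coordinate 0 lets the coordinates that vanish on a sublattice form
-- the block of the base point; this is the source of the +1 in { n+k+1 over n+1 }.
hat : ∀ {n} → Vector ℤ n → Vector ℤ (suc n)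
hat x = 0ℤ ∷ x

hat-cong : ∀ {n} {x y : Vector ℤ n} → x ≗ y → hat x ≗ hat y
hat-cong x≗y zero    = refl
hat-cong x≗y (suc i) = x≗y i

hat-zip : ∀ {n} (_∙_ : ℤ → ℤ → ℤ) → 0ℤ ∙ 0ℤ ≡ 0ℤ → (x y : Vector ℤ n) →
          ∀ k → hat (λ i → x i ∙ y i) k ≡ hat x k ∙ hat y k
hat-zip _∙_ 0∙0 x y zero    = sym 0∙0
hat-zip _∙_ 0∙0 x y (suc i) = refl

hat-• : ∀ {n} c (x : Vector ℤ n) k → hat (c • x) k ≡ c ℤ.* hat x k
hat-• c x zero    = sym (ℤ.*-zeroʳ c)
hat-• c x (suc i) = refl

module _ {u v : ℕ} (g : Growth u v) where

  embed : Vector ℤ v → Vector ℤ u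
  embed x i = hat x (label g (suc i))

  representative : ∀ j → ∃[ i ] label g (suc i) ≡ suc j
  representative j with label-surjective g (suc j)
  ... | suc i , eq = i , eq

  restrict : Vector ℤ u → Vector ℤ v
  restrict y j = y (proj₁ (representative j))

  restrict-embed : ∀ x → restrict (embed x) ≗ x
  restrict-embed x j = cong (hat x) (proj₂ (representative j))

  hat-embed : ∀ x k → hat (embed x) k ≡ hat x (label g k)
  hat-embed x zero    = refl
  hat-embed x (suc i) = refl

  -- As `hat y zero` is 0, this single condition also makes y vanish on the block of the base point.
  ConstantOnBlocks : Vector ℤ u → Set
  ConstantOnBlocks y = ∀ k l → label g k ≡ label g l → hat y k ≡ hat y l

  embed-constant : ∀ {x y} → y ≗ embed x → ConstantOnBlocks y
  embed-constant {x} y≗ k l eq = trans (hat-cong y≗ k) (trans (hat-embed x k)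
    (trans (cong (hat x) eq) (sym (trans (hat-cong y≗ l) (hat-embed x l)))))

  embed-restrict : ∀ {y} → ConstantOnBlocks y → embed (restrict y) ≗ y
  embed-restrict {y} const i with label g (suc i) in eq
  ... | zero  = const zero (suc i) (sym eq)
  ... | suc j = const (suc (proj₁ (representative j))) (suc i) (trans (proj₂ (representative j)) (sym eq))

  embed-cong : ∀ {x y} → x ≗ y → embed x ≗ embed y
  embed-cong x≗y i = hat-cong x≗y (label g (suc i))

  embed-minus : ∀ x y i → embed (λ j → x j ℤ.- y j) i ≡ embed x i ℤ.- embed y i
  embed-minus x y i = hat-zip ℤ._-_ refl x y (label g (suc i))

  embed-+ : ∀ x y i → embed (λ j → x j ℤ.+ y j) i ≡ embed x i ℤ.+ embed y i
  embed-+ x y i = hat-zip ℤ._+_ refl x y (label g (suc i))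

  embed-* : ∀ x y i → embed (λ j → x j ℤ.* y j) i ≡ embed x i ℤ.* embed y i
  embed-* x y i = hat-zip ℤ._*_ refl x y (label g (suc i))

  embed-• : ∀ c x i → embed (c • x) i ≡ c ℤ.* embed x i
  embed-• c x i = hat-• c x (label g (suc i))

  embed-0 : ∀ i → embed (λ _ → 0ℤ) i ≡ 0ℤ
  embed-0 i with label g (suc i)
  ... | zero  = refl
  ... | suc j = refl

  embed-sum : ∀ {m} (f : Fin m → Vector ℤ v) i → embed (λ j → sum (λ l → f l j)) i ≡ sum (λ l → embed (f l) i)
  embed-sum f i with label g (suc i)
  ... | zero  = sym (sum-zero {f = λ l → hat (f l) zero} (λ _ → refl))
  ... | suc j = refl

  pullback : Sublattice u → Sublattice v
  pullback L = record
    { member   = λ x → embed x ∈ member L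
    ; ∈-resp-≈ = λ x≗y → ∈-resp-≈ L (embed-cong x≗y)
    ; 0∈       = ∈-resp-≈ L (λ i → sym (embed-0 i)) (0∈ L)
    ; +-closed = λ {x} {y} x∈ y∈ → ∈-resp-≈ L (λ i → sym (embed-+ x y i)) (+-closed L x∈ y∈)
    ; •-closed = λ c {x} x∈ → ∈-resp-≈ L (λ i → sym (embed-• c x i)) (•-closed L c x∈)
    }

  pullback-*-closed : ∀ L → IsMultiplicativelyClosed L → IsMultiplicativelyClosed (pullback L)
  pullback-*-closed L *-closed {x} {y} x∈ y∈ = ∈-resp-≈ L (λ i → sym (embed-* x y i)) (*-closed x∈ y∈)

  image : Sublattice v → Sublattice u
  image L = record
    { member   = λ y → ∃[ x ] x ∈ member L × y ≗ embed x
    ; ∈-resp-≈ = λ { y≗z (x , x∈ , y≗) → x , x∈ , λ i → trans (sym (y≗z i)) (y≗ i) }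
    ; 0∈       = _ , 0∈ L , λ i → sym (embed-0 i)
    ; +-closed = λ { (x , x∈ , ≗x) (y , y∈ , ≗y) → _ , +-closed L x∈ y∈ ,
                     λ i → trans (cong₂ ℤ._+_ (≗x i) (≗y i)) (sym (embed-+ x y i)) }
    ; •-closed = λ { c (x , x∈ , ≗x) → _ , •-closed L c x∈ ,
                     λ i → trans (cong (c ℤ.*_) (≗x i)) (sym (embed-• c x i)) }
    }

  image-*-closed : ∀ L → IsMultiplicativelyClosed L → IsMultiplicativelyClosed (image L)
  image-*-closed L *-closed (x , x∈ , ≗x) (y , y∈ , ≗y) = _ , *-closed x∈ y∈ ,
    λ i → trans (cong₂ ℤ._*_ (≗x i) (≗y i)) (sym (embed-* x y i))

  module _ (L : Sublattice u) (M : Sublattice v) where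

    -- M corresponds to L under the isomorphism of ℤ^v with the vectors that
    -- are constant on the blocks of g and vanish on the block zero.
    record Restricts : Set where
      field
        constant : ∀ {y} → y ∈ member L → ConstantOnBlocks y
        embed-∈  : ∀ {x} → x ∈ member M → embed x ∈ member L
        embed-∈⁻ : ∀ {x} → embed x ∈ member L → x ∈ member M

  module _ {L : Sublattice u} {M : Sublattice v} (R : Restricts L M) where
    open Restricts R

    -- Saturation of the copy of ℤ^v: a nonzero m cancels from the equality of two coordinates of m
    -- y.
    torsion-constant : ∀ {m y} → NonZero m → (ℤ.+ m • y) ∈ member L → ConstantOnBlocks y
    torsion-constant {m} {y} m≢0 my∈ k l eq = ℤ.*-cancelˡ-≡ (ℤ.+ m) _ _ {{m≢0}}
      (trans (sym (hat-• (ℤ.+ m) y k)) (trans (constant my∈ k l eq) (hat-• (ℤ.+ m) y l)))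

    restrict-∈ : ∀ {y} → ConstantOnBlocks y → y ∈ member L → restrict y ∈ member M
    restrict-∈ const y∈ = embed-∈⁻ (∈-resp-≈ L (λ i → sym (embed-restrict const i)) y∈)

    -- On arbitrary vectors `restrict` loses information, but torsion vectors are constant on
    -- blocks, and there it is inverse to `embed`. Hence L and M share the same r.
    torsion-restricts : Inverse (torsionSetoid (quotientGroup L)) (torsionSetoid (quotientGroup M))
    torsion-restricts = record
      { to = to
      ; from = from
      ; to-cong = λ {x} {y} → to-cong x y
      ; from-cong = λ {x} {y} → from-cong x y
      ; inverse = (λ {x} {y} → invˡ x y) , (λ {y} {x} → invʳ y x)
      }
      where
      T = ∃ (HasFiniteOrder (quotientGroup L))
      U = ∃ (HasFiniteOrder (quotientGroup M))

      const : (y : T) → ConstantOnBlocks (proj₁ y)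
      const (y , m , m≢0 , my∈) = torsion-constant m≢0 (order⇒multiple L {m} {y} my∈)

      to : T → U
      to y*@(y , m , m≢0 , my∈) = restrict y , m , m≢0 , multiple⇒order M {m} {restrict y}
        (restrict-∈ (constant my∈′) my∈′)
        where my∈′ = order⇒multiple L {m} {y} my∈
      from : U → T
      from (x , m , m≢0 , mx∈) = embed x , m , m≢0 , multiple⇒order L {m} {embed x}
        (∈-resp-≈ L (embed-• (ℤ.+ m) x) (embed-∈ (order⇒multiple M {m} {x} mx∈)))

      to-cong : ∀ (x y : T) → (λ i → proj₁ x i ℤ.- proj₁ y i) ∈ member L →
                (λ j → restrict (proj₁ x) j ℤ.- restrict (proj₁ y) j) ∈ member M
      to-cong x y x-y∈ = restrict-∈ (constant x-y∈) x-y∈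

      from-cong : ∀ (x y : U) → (λ i → proj₁ x i ℤ.- proj₁ y i) ∈ member M →
                  (λ j → embed (proj₁ x) j ℤ.- embed (proj₁ y) j) ∈ member L
      from-cong x y x-y∈ = ∈-resp-≈ L (embed-minus (proj₁ x) (proj₁ y)) (embed-∈ x-y∈)

      invˡ : ∀ (x : U) (y : T) → (λ i → proj₁ y i ℤ.- embed (proj₁ x) i) ∈ member L →
             (λ j → restrict (proj₁ y) j ℤ.- proj₁ x j) ∈ member M
      invˡ (x , _) y y-x∈ = ∈-resp-≈ M (λ j → cong (λ a → proj₁ (to y) j ℤ.- a) (restrict-embed x j))
        (restrict-∈ (constant y-x∈) y-x∈)

      invʳ : ∀ (y : T) (x : U) → (λ j → proj₁ x j ℤ.- restrict (proj₁ y) j) ∈ member M →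
             (λ i → embed (proj₁ x) i ℤ.- proj₁ y i) ∈ member L
      invʳ y (x , _) x-y∈ = ∈-resp-≈ L (λ i → trans (embed-minus x (restrict (proj₁ y)) i)
        (cong (λ a → embed x i ℤ.- a) (embed-restrict (const y) i))) (embed-∈ x-y∈)

  image-restricts : ∀ L → Restricts (image L) L
  image-restricts L = record
    { constant = λ { (x , _ , y≗) → embed-constant y≗ }
    ; embed-∈  = λ {x} x∈ → x , x∈ , λ _ → refl
    ; embed-∈⁻ = λ { {x} (z , z∈ , eq) → ∈-resp-≈ L (λ j → trans (sym (restrict-embed z j))
                   (trans (sym (eq _)) (restrict-embed x j))) z∈ }
    }

  pullback-restricts : ∀ L → (∀ {y} → y ∈ member L → ConstantOnBlocks y) → Restricts L (pullback L)
  pullback-restricts L const = record { constant = const ; embed-∈ = id ; embed-∈⁻ = id }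

-- Rank

-- Membership of v in the rational span of b, with the denominator d cleared.
RationallySpans : ∀ {n m} → Vector (Vector ℤ n) m → Vector ℤ n → Set
RationallySpans {m = m} b v =
  Σ[ d ∈ ℤ ] d ≢ 0ℤ × Σ[ a ∈ Vector ℤ m ] (∀ j → d ℤ.* v j ≡ sum (λ l → a l ℤ.* b l j))

-- If the coefficient of v were 0, the relation would be a nontrivial one among the independent b.
-- So it can serve as the denominator.
dependent⇒spans : ∀ {n m} (b : Vector (Vector ℤ n) m) {v} →
                  LinearlyIndependent b → LinearlyDependent (v ∷ b) → RationallySpans b v
dependent⇒spans {n} {m} b {v} indep (c , c-rel , i , cᵢ≢0) =
  c zero , c₀≢0 , (λ l → ℤ.- c (suc l)) , λ j → begin
    c zero ℤ.* v j                                  ≡⟨ isolate (c zero ℤ.* v j) (s j) ⟩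
    (c zero ℤ.* v j ℤ.+ s j) ℤ.+ ℤ.-1ℤ ℤ.* s j        ≡⟨ cong (λ z → z ℤ.+ ℤ.-1ℤ ℤ.* s j) (rel j) ⟩
    0ℤ ℤ.+ ℤ.-1ℤ ℤ.* s j                             ≡⟨ ℤ.+-identityˡ _ ⟩
    ℤ.-1ℤ ℤ.* s j                                   ≡⟨ *-distribˡ-sum ℤ.-1ℤ (λ l → c (suc l) ℤ.* b l j) ⟩
    sum (λ l → ℤ.-1ℤ ℤ.* (c (suc l) ℤ.* b l j))      ≡⟨ sum-cong-≗ (λ l → negate (c (suc l)) (b l j)) ⟩
    sum (λ l → ℤ.- c (suc l) ℤ.* b l j)              ∎
  where
  open ≡-Reasoning
  s : Vector ℤ n
  s j = sum (λ l → c (suc l) ℤ.* b l j)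

  rel : ∀ j → c zero ℤ.* v j ℤ.+ s j ≡ 0ℤ
  rel j = trans (sym (linearCombination-apply c (v ∷ b) j)) (c-rel j)

  isolate : ∀ x y → x ≡ (x ℤ.+ y) ℤ.+ ℤ.-1ℤ ℤ.* y
  isolate = solve 2 (λ x y → x := (x :+ y) :+ con ℤ.-1ℤ :* y) refl
    where open +-*-Solver
  negate : ∀ x y → ℤ.-1ℤ ℤ.* (x ℤ.* y) ≡ ℤ.- x ℤ.* y
  negate = solve 2 (λ x y → con ℤ.-1ℤ :* (x :* y) := :- x :* y) refl
    where open +-*-Solver

  c₀≢0 : c zero ≢ 0ℤ
  c₀≢0 c₀≡0 = cᵢ≢0 (all-zero i)
    where
    s≡0 : ∀ j → s j ≡ 0ℤ
    s≡0 j = begin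
      s j                         ≡⟨ ℤ.+-identityˡ (s j) ⟨
      0ℤ ℤ.* v j ℤ.+ s j           ≡⟨ cong (λ c₀ → c₀ ℤ.* v j ℤ.+ s j) c₀≡0 ⟨
      c zero ℤ.* v j ℤ.+ s j       ≡⟨ rel j ⟩
      0ℤ                          ∎
    all-zero : ∀ i → c i ≡ 0ℤ
    all-zero zero    = c₀≡0
    all-zero (suc l) = indep (c ∘ suc) (λ j → trans (linearCombination-apply (c ∘ suc) b j) (s≡0 j)) l

∑-closed : ∀ {n} (L : Sublattice n) {m} (a : Vector ℤ m) (b : Vector (Vector ℤ n) m) →
           (∀ l → b l ∈ member L) → (λ j → sum (λ l → a l ℤ.* b l j)) ∈ member L
∑-closed L {zero}  a b b∈ = 0∈ L
∑-closed L {suc m} a b b∈ = +-closed L (•-closed L (a zero) (b∈ zero)) (∑-closed L (a ∘ suc) (b ∘ suc) (b∈ ∘ suc))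

-- An equivalent of rank n with explicit multiples of the unit vectors, the form in which products
-- of elements deliver it.
FullRank : ∀ {n} → Sublattice n → Set
FullRank L = ∀ j → Σ[ d ∈ ℤ ] d ≢ 0ℤ × (d • δ j) ∈ member L

-- The n+1 vectors x and b have a relation in n coordinates, and independence of b makes the
-- coefficient of x nonzero.
rank⇒multiple : ∀ {n} (L : Sublattice n) → HasRank L n → ∀ x → Σ[ d ∈ ℤ ] d ≢ 0ℤ × (d • x) ∈ member L
rank⇒multiple {n} L (b , b∈ , indep , _) x
  with t , t-rel , nontrivial ← exists-relation (ℕ.n<1+n n) (x ∷ b)
  with d , d≢0 , a , eq ← dependent⇒spans b {x} indep
         (t , (λ i → trans (linearCombination-apply t (x ∷ b) i) (t-rel i)) , nontrivial)
  = d , d≢0 , ∈-resp-≈ L (λ i → sym (eq i)) (∑-closed L a b b∈)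

rank⇒fullRank : ∀ {n} (L : Sublattice n) → HasRank L n → FullRank L
rank⇒fullRank L rank j = rank⇒multiple L rank (δ j)

fullRank⇒rank : ∀ {n} (L : Sublattice n) → FullRank L → HasRank L n
fullRank⇒rank {n} L full = b , (λ j → proj₂ (proj₂ (full j))) , indep , λ {v} _ → dependent v
  where
  d : Vector ℤ n
  d j = proj₁ (full j)
  b : Vector (Vector ℤ n) n
  b j = d j • δ j

  b-combination : ∀ c j → linearCombination c b j ≡ c j ℤ.* d j
  b-combination c j = begin
    linearCombination c b j                ≡⟨ linearCombination-apply c b j ⟩
    sum (λ i → c i ℤ.* (d i ℤ.* δ i j))     ≡⟨ sum-cong-≗ (λ i → sym (ℤ.*-assoc (c i) (d i) (δ i j))) ⟩
    sum (λ i → c i ℤ.* d i ℤ.* δ i j)       ≡⟨ sum-*δ (λ i → c i ℤ.* d i) j ⟩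
    c j ℤ.* d j                            ∎
    where open ≡-Reasoning

  indep : LinearlyIndependent b
  indep c c-rel j with ℤ.i*j≡0⇒i≡0∨j≡0 (c j) (trans (sym (b-combination c j)) (c-rel j))
  ... | inj₁ cⱼ≡0 = cⱼ≡0
  ... | inj₂ dⱼ≡0 = contradiction dⱼ≡0 (proj₁ (proj₂ (full j)))

  dependent : ∀ v → LinearlyDependent (v ∷ b)
  dependent v with t , t-rel , nontrivial ← exists-relation (ℕ.n<1+n n) (v ∷ b) =
    t , (λ i → trans (linearCombination-apply t (v ∷ b) i) (t-rel i)) , nontrivial

-- If m < w, the w coefficient vectors in ℤ^m satisfy a nontrivial relation t. Weighting it by the
-- denominators gives the relation with coefficients t i · d i among the a i, still nontrivial.
independent⇒≤ : ∀ {n m w} (b : Vector (Vector ℤ n) m) (a : Vector (Vector ℤ n) w) → LinearlyIndependent a →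
                (∀ i → RationallySpans b (a i)) → w ℕ.≤ m
independent⇒≤ {n} {m} {w} b a indep spans =
  ℕ.≮⇒≥ λ m<w → impossible (exists-relation m<w (λ i → proj₁ (proj₂ (proj₂ (spans i)))))
  where
  impossible : ¬ (Σ[ t ∈ Vector ℤ w ]
                  (∀ j → sum (λ i → t i ℤ.* proj₁ (proj₂ (proj₂ (spans i))) j) ≡ 0ℤ) × ∃[ i ] t i ≢ 0ℤ)
  impossible (t , t-rel , i , tᵢ≢0) = *-≢0 tᵢ≢0 (proj₁ (proj₂ (spans i))) (indep (λ i → t i ℤ.* d i) relation i)
    where
    d : Vector ℤ w
    d i = proj₁ (spans i)
    c : Fin w → Vector ℤ m
    c i = proj₁ (proj₂ (proj₂ (spans i)))
    relation : ∀ j → linearCombination (λ i → t i ℤ.* d i) a j ≡ 0ℤ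
    relation j = begin
      linearCombination (λ i → t i ℤ.* d i) a j
        ≡⟨ linearCombination-apply (λ i → t i ℤ.* d i) a j ⟩
      sum (λ i → t i ℤ.* d i ℤ.* a i j)
        ≡⟨ sum-cong-≗ (λ i → trans (ℤ.*-assoc (t i) (d i) (a i j))
             (trans (cong (t i ℤ.*_) (proj₂ (proj₂ (proj₂ (spans i))) j))
               (*-distribˡ-sum (t i) (λ l → c i l ℤ.* b l j)))) ⟩
      sum (λ i → sum (λ l → t i ℤ.* (c i l ℤ.* b l j)))
        ≡⟨ ∑-comm (λ i l → t i ℤ.* (c i l ℤ.* b l j)) ⟩
      sum (λ l → sum (λ i → t i ℤ.* (c i l ℤ.* b l j)))
        ≡⟨ sum-cong-≗ (λ l → trans (sum-cong-≗ (λ i → sym (ℤ.*-assoc (t i) (c i l) (b l j))))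
             (sym (*-distribʳ-sum (b l j) (λ i → t i ℤ.* c i l)))) ⟩
      sum (λ l → sum (λ i → t i ℤ.* c i l) ℤ.* b l j)
        ≡⟨ sum-zero (λ l → trans (cong (ℤ._* b l j) (t-rel l)) (ℤ.*-zeroˡ (b l j))) ⟩
      0ℤ ∎
      where open ≡-Reasoning

rank-unique : ∀ {n} (L : Sublattice n) {m w} → HasRank L m → HasRank L w → m ≡ w
rank-unique L (a , a∈ , a-indep , a-max) (b , b∈ , b-indep , b-max) = ℕ.≤-antisym
  (independent⇒≤ b a a-indep (λ i → dependent⇒spans b b-indep (b-max (a∈ i))))
  (independent⇒≤ a b b-indep (λ i → dependent⇒spans a a-indep (a-max (b∈ i))))

-- Rank and the classes of coordinates

module _ {u v : ℕ} (g : Growth u v) where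

  embed-combination : ∀ {m} c (b : Vector (Vector ℤ v) m) i →
                      linearCombination c (embed g ∘ b) i ≡ embed g (linearCombination c b) i
  embed-combination c b i = begin
    linearCombination c (embed g ∘ b) i              ≡⟨ linearCombination-apply c (embed g ∘ b) i ⟩
    sum (λ l → c l ℤ.* embed g (b l) i)               ≡⟨ sum-cong-≗ (λ l → embed-• g (c l) (b l) i) ⟨
    sum (λ l → embed g (c l • b l) i)                ≡⟨ embed-sum g (λ l → c l • b l) i ⟨
    embed g (λ j → sum (λ l → c l ℤ.* b l j)) i       ≡⟨ embed-cong g (linearCombination-apply c b) i ⟨
    embed g (linearCombination c b) i                ∎
    where open ≡-Reasoning

  -- `embed` is injective, with left inverse `restrict`, and reaches every vector of L, so it
  -- carries a maximal independent family of M to one of L.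
  restricts-rank : ∀ {L M m} → Restricts g L M → HasRank M m → HasRank L m
  restricts-rank {L} {M} R (b , b∈ , indep , maximal) =
    embed g ∘ b , (λ i → embed-∈ (b∈ i)) , indep′ , maximal′
    where
    open Restricts R
    indep′ : LinearlyIndependent (embed g ∘ b)
    indep′ c c-rel = indep c λ j → trans (sym (restrict-embed g (linearCombination c b) j))
      (trans (sym (embed-combination c b (proj₁ (representative g j)))) (c-rel (proj₁ (representative g j))))

    maximal′ : ∀ {y} → y ∈ member L → LinearlyDependent (y ∷ (embed g ∘ b))
    maximal′ {y} y∈ with maximal (restrict-∈ g R (constant y∈) y∈)
    ... | c , c-rel , nontrivial = c , (λ i → begin
        linearCombination c (y ∷ (embed g ∘ b)) i
          ≡⟨⟩
        c zero ℤ.* y i ℤ.+ linearCombination (c ∘ suc) (embed g ∘ b) i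
          ≡⟨ cong (λ z → c zero ℤ.* z ℤ.+ linearCombination (c ∘ suc) (embed g ∘ b) i)
               (embed-restrict g (constant y∈) i) ⟨
        linearCombination c (embed g ∘ (restrict g y ∷ b)) i
          ≡⟨ embed-combination c (restrict g y ∷ b) i ⟩
        embed g (linearCombination c (restrict g y ∷ b)) i
          ≡⟨ embed-cong g c-rel i ⟩
        embed g (λ _ → 0ℤ) i
          ≡⟨ embed-0 g i ⟩
        0ℤ ∎) , nontrivial
      where open ≡-Reasoning

  -- The kernel of `label g` is the relation of agreeing on L. `separated` supplies a witness
  -- instead of denying agreement, because these witnesses become the factors of the products in
  -- `isolate`.
  record Classifies (L : Sublattice u) : Set where
    field
      constant  : ∀ {y} → y ∈ member L → ConstantOnBlocks g y
      separated : ∀ k l → label g k ≢ label g l → ∃[ y ] y ∈ member L × hat y k ≢ hat y l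

  -- Of two distinct labels at least one is some `suc j`; the image of a multiple d of the unit
  -- vector at j is d on that block and 0 on the other.
  fullRank⇒classifies : ∀ {L M} → Restricts g L M → FullRank M → Classifies L
  fullRank⇒classifies {L} {M} R full = record { constant = constant ; separated = separated }
    where
    open Restricts R
    separates : ∀ k l j → label g k ≡ suc j → label g l ≢ suc j → ∃[ y ] y ∈ member L × hat y k ≢ hat y l
    separates k l j k↦j l↦̸j with d , d≢0 , d∈ ← full j =
      embed g (d • δ j) , embed-∈ d∈ , λ eq → d≢0 (begin
        d                                ≡⟨ ℤ.*-identityʳ d ⟨
        d ℤ.* 1ℤ                         ≡⟨ cong (d ℤ.*_) (δ-diag j) ⟨
        hat (d • δ j) (suc j)            ≡⟨ cong (hat (d • δ j)) k↦j ⟨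
        hat (d • δ j) (label g k)        ≡⟨ hat-embed g (d • δ j) k ⟨
        hat (embed g (d • δ j)) k        ≡⟨ eq ⟩
        hat (embed g (d • δ j)) l        ≡⟨ hat-embed g (d • δ j) l ⟩
        hat (d • δ j) (label g l)        ≡⟨ vanishes d (label g l) l↦̸j ⟩
        0ℤ                               ∎)
      where
      open ≡-Reasoning
      vanishes : ∀ d i → i ≢ suc j → hat (d • δ j) i ≡ 0ℤ
      vanishes d zero    i≢ = refl
      vanishes d (suc i) i≢ = trans (cong (d ℤ.*_) (δ-off (λ j≡i → i≢ (cong suc (sym j≡i))))) (ℤ.*-zeroʳ d)

    separated : ∀ k l → label g k ≢ label g l → ∃[ y ] y ∈ member L × hat y k ≢ hat y l
    separated k l k≢l with label g k in eqk | label g l in eql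
    ... | zero  | zero  = contradiction refl k≢l
    ... | suc i | _     = separates k l i eqk (λ eq → k≢l (trans (sym eq) eql))
    ... | zero  | suc j with y , y∈ , y≢ ← separates l k j eql (λ eq → k≢l (trans (sym eqk) eq)) =
      y , y∈ , y≢ ∘ sym

  module _ {L : Sublattice u} (C : Classifies L) (*-closed : IsMultiplicativelyClosed L) where
    private
      M = pullback g L
      open Classifies C

    classifies⇒restricts : Restricts g L M
    classifies⇒restricts = pullback-restricts g L constant

    private
      pull : ∀ {y} → y ∈ member L → restrict g y ∈ member M
      pull y∈ = restrict-∈ g classifies⇒restricts (constant y∈) y∈

      separate : ∀ {i j} → i ≢ j → ∃[ x ] x ∈ member M × x i ≢ x j
      separate {i} {j} i≢j
        with y , y∈ , y≢ ← separated (suc (proj₁ (representative g i))) (suc (proj₁ (representative g j)))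
               (λ eq → i≢j (Fin.suc-injective (trans (sym (proj₂ (representative g i)))
                 (trans eq (proj₂ (representative g j))))))
        = restrict g y , pull y∈ , y≢

      -- Separation of j from the base point, where `hat` is 0, means a nonzero entry; this starts
      -- the product in `isolate`.
      nonzero : ∀ j → ∃[ x ] x ∈ member M × x j ≢ 0ℤ
      nonzero j with y , y∈ , y≢ ← separated (suc (proj₁ (representative g j))) zero
                                     (λ eq → Fin.0≢1+n (trans (sym eq) (proj₂ (representative g j))))
        = restrict g y , pull y∈ , y≢

      -- Replacing p by p (x − x i) kills the coordinate i and stays in M
      -- although M need not contain 1.
      isolate : ∀ j {N} (f : Fin N → Fin v) →
                ∃[ p ] p ∈ member M × p j ≢ 0ℤ × (∀ i → f i ≢ j → p (f i) ≡ 0ℤ)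
      isolate j {zero} f with p , p∈ , p≢0 ← nonzero j = p , p∈ , p≢0 , λ ()
      isolate j {suc N} f with isolate j (f ∘ suc) | f zero Fin.≟ j
      ... | p , p∈ , p≢0 , vanish | yes f₀≡j = p , p∈ , p≢0 , λ
        { zero f₀≢j → contradiction f₀≡j f₀≢j ; (suc i) → vanish i }
      ... | p , p∈ , p≢0 , vanish | no f₀≢j with x , x∈ , x≢ ← separate f₀≢j =
        q , ∈-resp-≈ M (λ i → sym (factor (p i) (x i) (x (f zero))))
              (-‿closed M (pullback-*-closed g L *-closed p∈ x∈) (•-closed M (x (f zero)) p∈))
          , *-≢0 p≢0 (λ eq → x≢ (sym (ℤ.i-j≡0⇒i≡j (x j) (x (f zero)) eq)))
          , λ { zero _ → trans (cong (p (f zero) ℤ.*_) (ℤ.i≡j⇒i-j≡0 (refl {x = x (f zero)}))) (ℤ.*-zeroʳ (p (f zero)))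
              ; (suc i) fᵢ≢j → trans (cong (ℤ._* (x (f (suc i)) ℤ.- x (f zero))) (vanish i fᵢ≢j))
                                 (ℤ.*-zeroˡ (x (f (suc i)) ℤ.- x (f zero))) }
        where
        q : Vector ℤ v
        q i = p i ℤ.* (x i ℤ.- x (f zero))
        factor : ∀ p x c → p ℤ.* (x ℤ.- c) ≡ p ℤ.* x ℤ.- c ℤ.* p
        factor = solve 3 (λ p x c → p :* (x :- c) := p :* x :- c :* p) refl
          where open +-*-Solver

    -- Isolating j from all coordinates at once, with `id` as the list, leaves a vector supported at
    -- j alone.
    pullback-fullRank : FullRank M
    pullback-fullRank j with p , p∈ , p≢0 , vanish ← isolate j id =
      p j , p≢0 , ∈-resp-≈ M p≗ p∈
      where
      p≗ : p ≗ (p j • δ j)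
      p≗ i with i Fin.≟ j
      ... | yes refl = sym (trans (cong (p i ℤ.*_) (δ-diag i)) (ℤ.*-identityʳ (p i)))
      ... | no i≢j = trans (vanish i i≢j) (sym (trans (cong (p j ℤ.*_) (δ-off (i≢j ∘ sym))) (ℤ.*-zeroʳ (p j))))

    classifies⇒rank : HasRank L v
    classifies⇒rank = restricts-rank {L} {M} classifies⇒restricts (fullRank⇒rank M pullback-fullRank)

classifies-resp-≐ : ∀ {u v} {g : Growth u v} {L M} → member L ≐ member M → Classifies g L → Classifies g M
classifies-resp-≐ (L⊆M , M⊆L) C = record
  { constant  = λ y∈ → constant (M⊆L y∈)
  ; separated = λ k l k≢l → let y , y∈ , y≢ = separated k l k≢l in y , L⊆M y∈ , y≢
  }
  where open Classifies C

-- Both labellings have agreement on L as their kernel, and a growth is determined by its kernel.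
classifies-unique : ∀ {u v} {g h : Growth u v} {L} → Classifies g L → Classifies h L → g ≡ h
classifies-unique {g = g} {h} {L} C D = Growth-unique g h λ k l → refine C D k l , refine D C k l
  where
  refine : ∀ {v w} {g : Growth _ v} {h : Growth _ w} → Classifies g L → Classifies h L →
           ∀ k l → label g k ≡ label g l → label h k ≡ label h l
  refine {g = g} {h} C D k l eq with label h k Fin.≟ label h l
  ... | yes eq′ = eq′
  ... | no k≢l with y , y∈ , y≢ ← Classifies.separated D k l k≢l =
    contradiction (Classifies.constant C y∈ k l eq) y≢

-- Agreement of two coordinates on the finite family b is decidable, and it implies agreement on L
-- because a nonzero multiple of each y in L is a combination of b. The values are stored in a
-- `Vec`, whose equality is decidable as `classify` requires.
classification : ∀ {u m} (L : Sublattice u) → HasRank L m → ∃[ v ] Σ[ g ∈ Growth u v ] Classifies g L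
classification {u} {m} L (b , b∈ , indep , maximal) = classifies
  where
  values : Fin (suc u) → Vec.Vec ℤ m
  values k = Vec.tabulate (λ l → hat (b l) k)

  values-determine : ∀ {y} → y ∈ member L → ∀ k l → values k ≡ values l → hat y k ≡ hat y l
  values-determine {y} y∈ k l eq with d , d≢0 , a , da ← dependent⇒spans b indep (maximal y∈) =
    *-cancelˡ d≢0 (trans (expand k) (trans (sum-cong-≗ (λ i → cong (a i ℤ.*_) (bs i))) (sym (expand l))))
    where
    bs : ∀ i → hat (b i) k ≡ hat (b i) l
    bs i = trans (sym (Vec.lookup∘tabulate (λ i → hat (b i) k) i))
      (trans (cong (λ xs → Vec.lookup xs i) eq) (Vec.lookup∘tabulate (λ i → hat (b i) l) i))
    expand : ∀ k → d ℤ.* hat y k ≡ sum (λ i → a i ℤ.* hat (b i) k)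
    expand zero    = trans (ℤ.*-zeroʳ d) (sym (sum-zero (λ i → ℤ.*-zeroʳ (a i))))
    expand (suc j) = da j

  classifies : ∃[ v ] Σ[ g ∈ Growth u v ] Classifies g L
  classifies with v , g , h , h-inj , h-label ← classify (Vec.≡-dec ℤ._≟_) values = v , g , record
    { constant  = λ y∈ k l eq → values-determine y∈ k l (proj₁ (same k l) eq)
    ; separated = separated
    }
    where
    same : SameKernel (label g) values
    same = sameKernel h h-inj h-label
    separated : ∀ k l → label g k ≢ label g l → ∃[ y ] y ∈ member L × hat y k ≢ hat y l
    separated k l k≢l with Fin.any? (λ i → ¬? (hat (b i) k ℤ.≟ hat (b i) l))
    ... | yes (i , bᵢ≢) = b i , b∈ i , bᵢ≢
    ... | no ∄i = contradiction (proj₂ (same k l) (Vec.tabulate-cong λ i →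
                    decidable-stable (hat (b i) k ℤ.≟ hat (b i) l) (λ bᵢ≢ → ∄i (i , bᵢ≢)))) k≢l

-- Finiteness of φₙ(r)

indicator : ∀ {p} {P : Set p} → Dec P → Fin 2
indicator (yes _) = zero
indicator (no _)  = suc zero

indicator⁺ : ∀ {p} {P : Set p} (P? : Dec P) → P → indicator P? ≡ zero
indicator⁺ (yes _) p = refl
indicator⁺ (no ¬p) p = contradiction p ¬p

indicator⁻ : ∀ {p} {P : Set p} (P? : Dec P) → indicator P? ≡ zero → P
indicator⁻ (yes p) _ = p

witness : ∀ {a p} {A : Set a} {P : A → Set p} → Dec (∃ P) → Maybe A
witness (yes (x , _)) = just x
witness (no _)        = nothing

witness-just : ∀ {a p} {A : Set a} {P : A → Set p} (∃P? : Dec (∃ P)) → ∃ P → ∃[ x ] witness ∃P? ≡ just x × P x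
witness-just (yes (x , px)) _  = x , refl , px
witness-just (no ∄P)        ∃P = contradiction ∃P ∄P

torsion-≐ : ∀ {n} {L M : Sublattice n} → member L ≐ member M →
            Inverse (torsionSetoid (quotientGroup L)) (torsionSetoid (quotientGroup M))
torsion-≐ {L = L} {M} (L⊆M , M⊆L) = record
  { to = λ { (x , m , m≢0 , mx∈) → x , m , m≢0 , multiple⇒order M {m} {x} (L⊆M (order⇒multiple L {m} {x} mx∈)) }
  ; from = λ { (x , m , m≢0 , mx∈) → x , m , m≢0 , multiple⇒order L {m} {x} (M⊆L (order⇒multiple M {m} {x} mx∈)) }
  ; to-cong = L⊆M
  ; from-cong = M⊆L
  ; inverse = L⊆M , M⊆L
  }

corank0⇒rank : ∀ {n} {L : Sublattice n} → HasCorank L 0 → HasRank L n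
corank0⇒rank {L = L} (m , rank , m+0≡n) = subst (HasRank L) (trans (sym (ℕ.+-identityʳ m)) m+0≡n) rank

rank⇒corank0 : ∀ {n} {L : Sublattice n} → HasRank L n → HasCorank L 0
rank⇒corank0 rank = _ , rank , ℕ.+-identityʳ _

module _ {n : ℕ} (L : Sublattice n) where

  -- An order is a positive natural number while d may be negative, so its absolute value, a
  -- multiple of d, is taken.
  multiple⇒torsion : ∀ d x → d ≢ 0ℤ → (d • x) ∈ member L → HasFiniteOrder (quotientGroup L) x
  multiple⇒torsion d x d≢0 dx∈ with divides k ∣d∣≡kd ← ℤ∣.m∣∣m∣ {d} =
    ℤ.∣ d ∣ , ℕ.≢-nonZero (d≢0 ∘ ℤ.∣i∣≡0⇒i≡0) , multiple⇒order L {ℤ.∣ d ∣} {x}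
      (∈-resp-≈ L (λ i → trans (sym (ℤ.*-assoc k d (x i))) (cong (ℤ._* x i) (sym ∣d∣≡kd))) (•-closed L k dx∈))

module _ {n r : ℕ} (L : MultiplicativeSublattice n 0 r) where
  private
    Λ = sublattice L
    open Inverse (torsionCard L) using (to; to-cong)
    open Injection (Inverseₚ.Inverse⇒Injection (torsionCard L)) using (injective)

    abstract
      torsion : ∀ x → HasFiniteOrder (quotientGroup Λ) x
      torsion x = let d , d≢0 , dx∈ = rank⇒multiple Λ (corank0⇒rank {L = Λ} (corank L)) x in
        multiple⇒torsion Λ d x d≢0 dx∈

    element : Vector ℤ n → ∃ (HasFiniteOrder (quotientGroup Λ))
    element x = x , torsion x

    -- In full rank every vector is torsion, so the count of the torsion group numbers all cosets of
    -- the lattice.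
    class : Vector ℤ n → Fin r
    class x = to (element x)

    class-injective : ∀ {x y} → class x ≡ class y → (λ i → x i ℤ.- y i) ∈ member Λ
    class-injective {x} {y} eq = injective {element x} {element y} eq

    class-cong : ∀ {x y} → (λ i → x i ℤ.- y i) ∈ member Λ → class x ≡ class y
    class-cong {x} {y} x-y∈ = to-cong {element x} {element y} x-y∈

    m∣m! : ∀ {m} → 0 ℕ.< m → m ℕ∣.∣ m !
    m∣m! {suc m} _ = ℕ∣.m∣m*n (m !)

    -0-identity : ∀ (x : Vector ℤ n) → (λ i → x i ℤ.- 0ℤ) ≗ x
    -0-identity x i = ℤ.+-identityʳ (x i)

  infix 4 _∈?_
  -- Membership means lying in the coset of 0, and coset numbers are compared in `Fin r`.
  _∈?_ : ∀ x → Dec (x ∈ member Λ)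
  _∈?_ x = map′
    (λ eq → ∈-resp-≈ Λ (-0-identity x) (class-injective eq))
    (λ x∈ → class-cong (∈-resp-≈ Λ (λ i → sym (-0-identity x i)) x∈))
    (class x Fin.≟ class (λ _ → 0ℤ))

  -- Two of the r + 1 multiples 0 x, …, r x agree modulo L.
  factorial-period : ∀ x → (ℤ.+ (r !) • x) ∈ member Λ
  factorial-period x
    with i , j , i<j , eq ← Fin.pigeonhole (ℕ.n<1+n r) (λ i → class (ℤ.+ toℕ i • x))
    -- The difference j - i is positive and at most r, hence divides r!; it depends on x, but r!
    -- does not.
    with ℕ∣.divides c r!≡ ← ℕ∣.∣-trans (m∣m! (ℕ.m<n⇒0<n∸m i<j))
           (ℕ∣.m≤n⇒m!∣n! (ℕ.≤-trans (ℕ.m∸n≤m (toℕ j) (toℕ i)) (ℕ.s≤s⁻¹ (Fin.toℕ<n j))))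
    = ∈-resp-≈ Λ (λ k → begin
        ℤ.+ c ℤ.* (ℤ.+ toℕ j ℤ.* x k ℤ.- ℤ.+ toℕ i ℤ.* x k) ≡⟨ factor (ℤ.+ c) (ℤ.+ toℕ j) (ℤ.+ toℕ i) (x k) ⟩
        ℤ.+ c ℤ.* (ℤ.+ toℕ j ℤ.- ℤ.+ toℕ i) ℤ.* x k
          ≡⟨ cong (λ d → ℤ.+ c ℤ.* d ℤ.* x k) (trans (ℤ.m-n≡m⊖n (toℕ j) (toℕ i)) (ℤ.⊖-≥ (ℕ.<⇒≤ i<j))) ⟩
        ℤ.+ c ℤ.* ℤ.+ (toℕ j ∸ toℕ i) ℤ.* x k ≡⟨ cong (ℤ._* x k) (ℤ.pos-* c (toℕ j ∸ toℕ i)) ⟨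
        ℤ.+ (c * (toℕ j ∸ toℕ i)) ℤ.* x k ≡⟨ cong (λ m → ℤ.+ m ℤ.* x k) r!≡ ⟨
        ℤ.+ (r !) ℤ.* x k ∎)
      (•-closed Λ (ℤ.+ c) (class-injective (sym eq)))
    where
    open ≡-Reasoning
    factor : ∀ c j i x → c ℤ.* (j ℤ.* x ℤ.- i ℤ.* x) ≡ c ℤ.* (j ℤ.- i) ℤ.* x
    factor = solve 4 (λ c j i x → c :* (j :* x :- i :* x) := c :* (j :- i) :* x) refl
      where open +-*-Solver

-- Sublattices as unions of residue classes

module Residues (n M : ℕ) .{{_ : NonZero M}} where

  infix 4 _∼_ _∼?_
  record _∼_ (x y : Vector ℤ n) : Set where
    constructor congruent
    field
      difference : ∀ i → ℤ.+ M ∣ x i ℤ.- y i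
  open _∼_

  _∼?_ : Decidable₂ _∼_
  x ∼? y = map′ congruent difference (Fin.all? λ i → ℤ.+ M ∣? x i ℤ.- y i)

  ∼-reflexive : ∀ {x y} → x ≗ y → x ∼ y
  ∼-reflexive x≗y = congruent λ i → divides 0ℤ (ℤ.i≡j⇒i-j≡0 (x≗y i))

  ∼-trans : ∀ {x y z} → x ∼ y → y ∼ z → x ∼ z
  ∼-trans {x} {y} {z} x∼y y∼z = congruent λ i →
    subst (ℤ.+ M ∣_) (telescope (x i) (y i) (z i)) (ℤ∣.∣m∣n⇒∣m+n (difference x∼y i) (difference y∼z i))
    where
    open +-*-Solver
    telescope : ∀ x y z → (x ℤ.- y) ℤ.+ (y ℤ.- z) ≡ x ℤ.- z
    telescope = solve 3 (λ x y z → (x :- y) :+ (y :- z) := x :- z) refl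

  ∼-sym : ∀ {x y} → x ∼ y → y ∼ x
  ∼-sym {x} {y} x∼y = congruent λ i → subst (ℤ.+ M ∣_) (swap (x i) (y i)) (ℤ∣.∣m⇒∣-m (difference x∼y i))
    where
    open +-*-Solver
    swap : ∀ x y → ℤ.- (x ℤ.- y) ≡ y ℤ.- x
    swap = solve 2 (λ x y → :- (x :- y) := y :- x) refl

  +-∼ : ∀ {x y z w} → x ∼ y → z ∼ w → (λ i → x i ℤ.+ z i) ∼ (λ i → y i ℤ.+ w i)
  +-∼ {x} {y} {z} {w} x∼y z∼w = congruent λ i →
    subst (ℤ.+ M ∣_) (exchange (x i) (y i) (z i) (w i)) (ℤ∣.∣m∣n⇒∣m+n (difference x∼y i) (difference z∼w i))
    where
    open +-*-Solver
    exchange : ∀ x y z w → (x ℤ.- y) ℤ.+ (z ℤ.- w) ≡ (x ℤ.+ z) ℤ.- (y ℤ.+ w)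
    exchange = solve 4 (λ x y z w → (x :- y) :+ (z :- w) := (x :+ z) :- (y :+ w)) refl

  *-∼ : ∀ {x y z w} → x ∼ y → z ∼ w → (λ i → x i ℤ.* z i) ∼ (λ i → y i ℤ.* w i)
  *-∼ {x} {y} {z} {w} x∼y z∼w = congruent λ i → subst (ℤ.+ M ∣_) (exchange (x i) (y i) (z i) (w i))
    (ℤ∣.∣m∣n⇒∣m+n (ℤ∣.∣m⇒∣m*n (z i) (difference x∼y i)) (ℤ∣.∣n⇒∣m*n (y i) (difference z∼w i)))
    where
    open +-*-Solver
    exchange : ∀ x y z w → (x ℤ.- y) ℤ.* z ℤ.+ y ℤ.* (z ℤ.- w) ≡ x ℤ.* z ℤ.- y ℤ.* w
    exchange = solve 4 (λ x y z w → (x :- y) :* z :+ y :* (z :- w) := x :* z :- y :* w) refl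

  Residue : Set
  Residue = Fin (M ^ n)

  ⟦_⟧ : Residue → Vector ℤ n
  ⟦ a ⟧ i = ℤ.+ toℕ (finToFun {M} {n} a i)

  residue : ∀ x → ∃[ a ] x ∼ ⟦ a ⟧
  residue x = funToFin digit , congruent λ i → divides (x i ℤ./ℕ M) (begin
      x i ℤ.- ⟦ funToFin digit ⟧ i       ≡⟨ cong (λ d → x i ℤ.- ℤ.+ toℕ d) (Fin.finToFun-funToFin digit i) ⟩
      x i ℤ.- ℤ.+ toℕ (digit i)          ≡⟨ cong (λ d → x i ℤ.- ℤ.+ d) (Fin.toℕ-fromℕ< (ℤ.n%ℕd<d (x i) M)) ⟩
      x i ℤ.- ℤ.+ (x i ℤ.%ℕ M)           ≡⟨ cong (λ z → z ℤ.- ℤ.+ (x i ℤ.%ℕ M)) (ℤ.a≡a%ℕn+[a/ℕn]*n (x i) M) ⟩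
      (ℤ.+ (x i ℤ.%ℕ M) ℤ.+ x i ℤ./ℕ M ℤ.* ℤ.+ M) ℤ.- ℤ.+ (x i ℤ.%ℕ M)
        ≡⟨ drop (ℤ.+ (x i ℤ.%ℕ M)) (x i ℤ./ℕ M ℤ.* ℤ.+ M) ⟩
      x i ℤ./ℕ M ℤ.* ℤ.+ M ∎)
    where
    open ≡-Reasoning
    digit : Fin n → Fin M
    digit i = fromℕ< (ℤ.n%ℕd<d (x i) M)
    drop : ∀ a b → (a ℤ.+ b) ℤ.- a ≡ b
    drop = solve 2 (λ a b → (a :+ b) :- a := b) refl
      where open +-*-Solver

  Periodic : Sublattice n → Set
  Periodic L = ∀ x → (ℤ.+ M • x) ∈ member L

  periodic-resp-∼ : ∀ L → Periodic L → ∀ {x y} → x ∼ y → y ∈ member L → x ∈ member L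
  periodic-resp-∼ L period {x} {y} x∼y y∈ = ∈-resp-≈ L (λ i → begin
      y i ℤ.+ ℤ.+ M ℤ.* quot i
        ≡⟨ cong (ℤ._+_ (y i)) (trans (ℤ.*-comm (ℤ.+ M) (quot i)) (sym (_∣_.equality (difference x∼y i)))) ⟩
      y i ℤ.+ (x i ℤ.- y i)       ≡⟨ add-back (y i) (x i) ⟩
      x i ∎) (+-closed L y∈ (period quot))
    where
    open ≡-Reasoning
    quot : Vector ℤ n
    quot i = _∣_.quotient (difference x∼y i)
    add-back : ∀ y x → y ℤ.+ (x ℤ.- y) ≡ x
    add-back = solve 2 (λ y x → y :+ (x :- y) := x) refl
      where open +-*-Solver

  -- Scalars matter only modulo M, which turns closure under all of ℤ into the finite check `•-T`.
  scalar : ∀ c → ∃[ d ] ∀ (x : Vector ℤ n) → (c • x) ∼ (ℤ.+ toℕ {M} d • x)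
  scalar c = fromℕ< (ℤ.n%ℕd<d c M) , λ x → congruent λ i → divides (c ℤ./ℕ M ℤ.* x i) (begin
      c ℤ.* x i ℤ.- ℤ.+ toℕ (fromℕ< (ℤ.n%ℕd<d c M)) ℤ.* x i
        ≡⟨ cong₂ (λ c d → c ℤ.* x i ℤ.- ℤ.+ d ℤ.* x i) (ℤ.a≡a%ℕn+[a/ℕn]*n c M) (Fin.toℕ-fromℕ< (ℤ.n%ℕd<d c M)) ⟩
      (ℤ.+ (c ℤ.%ℕ M) ℤ.+ c ℤ./ℕ M ℤ.* ℤ.+ M) ℤ.* x i ℤ.- ℤ.+ (c ℤ.%ℕ M) ℤ.* x i
        ≡⟨ drop (ℤ.+ (c ℤ.%ℕ M)) (c ℤ./ℕ M) (ℤ.+ M) (x i) ⟩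
      c ℤ./ℕ M ℤ.* x i ℤ.* ℤ.+ M ∎)
    where
    open ≡-Reasoning
    drop : ∀ a q m x → (a ℤ.+ q ℤ.* m) ℤ.* x ℤ.- a ℤ.* x ≡ q ℤ.* x ℤ.* m
    drop = solve 4 (λ a q m x → (a :+ q :* m) :* x :- a :* x := q :* x :* m) refl
      where open +-*-Solver

  module _ (T : Pred Residue 0ℓ) where

    Union : Pred (Vector ℤ n) 0ℓ
    Union x = ∃[ a ] T a × x ∼ ⟦ a ⟧

    Union-resp-∼ : ∀ {x y} → x ∼ y → y ∈ Union → x ∈ Union
    Union-resp-∼ x∼y (a , Ta , y∼a) = a , Ta , ∼-trans x∼y y∼a

    ⟦⟧-Union : ∀ {a} → T a → ⟦ a ⟧ ∈ Union
    ⟦⟧-Union {a} Ta = a , Ta , ∼-reflexive (λ _ → refl)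

    -- Every condition ranges over finitely many residues and scalars, so it is decidable for
    -- decidable T. Compatibility of the operations with congruence extends it to the whole union.
    record IsSubring : Set where
      field
        0∈-T : (λ _ → 0ℤ) ∈ Union
        +-T  : ∀ a b → T a → T b → (λ i → ⟦ a ⟧ i ℤ.+ ⟦ b ⟧ i) ∈ Union
        *-T  : ∀ a b → T a → T b → (λ i → ⟦ a ⟧ i ℤ.* ⟦ b ⟧ i) ∈ Union
        •-T  : ∀ (c : Fin M) a → T a → (ℤ.+ toℕ c • ⟦ a ⟧) ∈ Union

    module _ (S : IsSubring) where
      open IsSubring S

      unionLattice : Sublattice n
      unionLattice = record
        { member   = Union
        ; ∈-resp-≈ = λ x≗y → Union-resp-∼ (∼-reflexive (λ i → sym (x≗y i)))
        ; 0∈       = 0∈-T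
        ; +-closed = λ { (a , Ta , x∼a) (b , Tb , y∼b) → Union-resp-∼ (+-∼ x∼a y∼b) (+-T a b Ta Tb) }
        ; •-closed = λ { c {x} (a , Ta , x∼a) → let d , c∼d = scalar c in
            Union-resp-∼
              (∼-trans (c∼d x) (*-∼ {x = λ _ → ℤ.+ toℕ d} {λ _ → ℤ.+ toℕ d} (∼-reflexive (λ _ → refl)) x∼a))
              (•-T d a Ta) }
        }

      unionLattice-*-closed : IsMultiplicativelyClosed unionLattice
      unionLattice-*-closed (a , Ta , x∼a) (b , Tb , y∼b) = Union-resp-∼ (*-∼ x∼a y∼b) (*-T a b Ta Tb)

      unionLattice-periodic : Periodic unionLattice
      unionLattice-periodic x = Union-resp-∼
        (congruent λ i → divides (x i) (trans (ℤ.+-identityʳ _) (ℤ.*-comm (ℤ.+ M) (x i))))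
        0∈-T

      +M≢0 : ℤ.+ M ≢ 0ℤ
      +M≢0 = ℕ.≢-nonZero⁻¹ M ∘ ℤ.+-injective

      unionLattice-rank : HasRank unionLattice n
      unionLattice-rank = fullRank⇒rank unionLattice (λ j → ℤ.+ M , +M≢0 , unionLattice-periodic (δ j))

      residueTorsion : Residue → ∃ (HasFiniteOrder (quotientGroup unionLattice))
      residueTorsion a = ⟦ a ⟧ , multiple⇒torsion unionLattice (ℤ.+ M) ⟦ a ⟧ +M≢0 (unionLattice-periodic ⟦ a ⟧)

      ∼⇒-∈ : ∀ {x y} → x ∼ y → (λ i → x i ℤ.- y i) ∈ Union
      ∼⇒-∈ {x} {y} x∼y = Union-resp-∼ {y = λ _ → 0ℤ}
        (congruent λ i → subst (ℤ.+ M ∣_) (sym (ℤ.+-identityʳ (x i ℤ.- y i))) (difference x∼y i)) 0∈-T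

    lattice⇒IsSubring : ∀ {r} (L : MultiplicativeSublattice n 0 r) → member (sublattice L) ≐ Union → IsSubring
    lattice⇒IsSubring L (L⊆U , U⊆L) = record
      { 0∈-T = L⊆U (0∈ (sublattice L))
      ; +-T  = λ a b Ta Tb → L⊆U (+-closed (sublattice L) {⟦ a ⟧} {⟦ b ⟧} (U⊆L (⟦⟧-Union Ta)) (U⊆L (⟦⟧-Union Tb)))
      ; *-T  = λ a b Ta Tb → L⊆U (*-closed L {⟦ a ⟧} {⟦ b ⟧} (U⊆L (⟦⟧-Union Ta)) (U⊆L (⟦⟧-Union Tb)))
      ; •-T  = λ c a Ta → L⊆U (•-closed (sublattice L) (ℤ.+ toℕ c) {⟦ a ⟧} (U⊆L (⟦⟧-Union Ta)))
      }

    IsSubring⇒lattice : ∀ (S : IsSubring) {r} → torsionSetoid (quotientGroup (unionLattice S)) HasCardinality r →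
                        MultiplicativeSublattice n 0 r
    IsSubring⇒lattice S card = record
      { sublattice  = unionLattice S
      ; *-closed    = λ {u} {v} → unionLattice-*-closed S {u} {v}
      ; corank      = rank⇒corank0 {L = unionLattice S} (unionLattice-rank S)
      ; torsionCard = card
      }

    lattice⇒index : ∀ (S : IsSubring) {r} (L : MultiplicativeSublattice n 0 r) → member (sublattice L) ≐ Union →
                      torsionSetoid (quotientGroup (unionLattice S)) HasCardinality r
    lattice⇒index S L L≐U = Inverseₚ.trans
      (Inverseₚ.sym (torsion-≐ {L = sublattice L} {M = unionLattice S} L≐U)) (torsionCard L)

  module _ {T : Pred Residue 0ℓ} (T? : Decidable T) where

    Union? : Decidable (Union T)
    Union? x = Fin.any? λ a → T? a ×-dec x ∼? ⟦ a ⟧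

    IsSubring? : Dec (IsSubring T)
    IsSubring? = map′
      (λ { (z , p , t , s) → record { 0∈-T = z ; +-T = p ; *-T = t ; •-T = s } })
      (λ S → let open IsSubring S in 0∈-T , +-T , *-T , •-T)
      (Union? _ ×-dec
       (Fin.all? λ a → Fin.all? λ b → T? a →-dec T? b →-dec Union? _) ×-dec
       (Fin.all? λ a → Fin.all? λ b → T? a →-dec T? b →-dec Union? _) ×-dec
       (Fin.all? λ c → Fin.all? λ a → T? a →-dec Union? _))

    -- The union contains M ℤ^n, so the residues represent all its cosets, possibly with repetition.
    unionLattice-torsion : (S : IsSubring T) → ∃[ N ] torsionSetoid (quotientGroup (unionLattice T S)) HasCardinality N
    unionLattice-torsion S = finite⇒cardinality (torsionSetoid (quotientGroup (unionLattice T S)))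
      (λ x y → Union? (λ i → proj₁ x i ℤ.- proj₁ y i))
      (λ a → just (residueTorsion T S a))
      (λ x → let a , x∼a = residue (proj₁ x) in a , residueTorsion T S a , refl , ∼⇒-∈ T S {proj₁ x} {⟦ a ⟧} x∼a)

    -- A subring of residues determines its index N, which is counted and compared with r. Any L
    -- with the same elements would have index N as well, so N ≠ r excludes it.
    union? : ∀ r → Dec (Σ[ L ∈ MultiplicativeSublattice n 0 r ] member (sublattice L) ≐ Union T)
    union? r = decide IsSubring?
      where
      decide-index : (S : IsSubring T) → ∃[ N ] torsionSetoid (quotientGroup (unionLattice T S)) HasCardinality N →
                     Dec (Σ[ L ∈ MultiplicativeSublattice n 0 r ] member (sublattice L) ≐ Union T)
      decide-index S (N , card) = map′
        (λ N≡r → IsSubring⇒lattice T S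
            (subst (torsionSetoid (quotientGroup (unionLattice T S)) HasCardinality_) N≡r card) , id , id)
        (λ { (L , L≐U) → HasCardinality-unique (torsionSetoid (quotientGroup (unionLattice T S)))
               card (lattice⇒index T S L L≐U) })
        (N ℕ.≟ r)

      decide : Dec (IsSubring T) → Dec (Σ[ L ∈ MultiplicativeSublattice n 0 r ] member (sublattice L) ≐ Union T)
      decide (no ¬S) = no λ { (L , L≐U) → ¬S (lattice⇒IsSubring T L L≐U) }
      decide (yes S) = decide-index S (unionLattice-torsion S)

module _ (n r : ℕ) where
  private
    instance _ = r ℕ.!≢0
    open Residues n (r !)
    open Setoid (multiplicativeSublattices n 0 r) using (_≈_) renaming (Carrier to Lattice)

    Selected : Fin (2 ^ ((r !) ^ n)) → Pred Residue 0ℓ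
    Selected c a = finToFun c a ≡ zero

    selected? : ∀ c → Decidable (Selected c)
    selected? c a = finToFun c a Fin.≟ zero

    ∈⟦⟧ : (L : Lattice) → Residue → Set
    ∈⟦⟧ L a = ⟦ a ⟧ ∈ member (sublattice L)

    respects : ∀ (L : Lattice) {x y} → x ∼ y → y ∈ member (sublattice L) → x ∈ member (sublattice L)
    respects L = periodic-resp-∼ (sublattice L) (factorial-period L)

    -- Both lattices have period r!, so it suffices to compare them on the finitely many
    -- representatives.
    _≈?_ : Decidable₂ _≈_
    L ≈? K = map′
      (λ p → included L K (proj₁ ∘ p) , included K L (proj₂ ∘ p))
      (λ { (L⊆K , K⊆L) a → L⊆K , K⊆L })
      (Fin.all? λ a → (_∈?_ L ⟦ a ⟧ →-dec _∈?_ K ⟦ a ⟧) ×-dec (_∈?_ K ⟦ a ⟧ →-dec _∈?_ L ⟦ a ⟧))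
      where
      included : ∀ L K → (∀ a → ∈⟦⟧ L a → ∈⟦⟧ K a) → ∀ {x} → x ∈ member (sublattice L) → x ∈ member (sublattice K)
      included L K p {x} x∈ with a , x∼a ← residue x =
        respects K x∼a (p a (respects L (∼-sym x∼a) x∈))

    enumerate : Fin (2 ^ ((r !) ^ n)) → Maybe Lattice
    enumerate c = witness (union? (selected? c) r)

    code : Lattice → Fin ((r !) ^ n) → Fin 2
    code L a = indicator (_∈?_ L ⟦ a ⟧)

    code-union : ∀ L → member (sublattice L) ≐ Union (Selected (funToFin (code L)))
    code-union L =
        (λ {x} x∈ → let a , x∼a = residue x in
          a , trans (Fin.finToFun-funToFin (code L) a)
                (indicator⁺ (_∈?_ L ⟦ a ⟧) (respects L (∼-sym x∼a) x∈)) , x∼a)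
      , (λ { (a , Ta , x∼a) → respects L x∼a
          (indicator⁻ (_∈?_ L ⟦ a ⟧) (trans (sym (Fin.finToFun-funToFin (code L) a)) Ta)) })

    enumerated : ∀ L → ∃[ c ] ∃[ K ] enumerate c ≡ just K × L ≈ K
    enumerated L =
      let L⊆U , U⊆L = code-union L
          -- The search may return a K with other evidence than L, but both have the elements of the
          -- same union.
          K , eq , K⊆U , U⊆K = witness-just (union? (selected? (funToFin (code L))) r) (L , L⊆U , U⊆L)
      in funToFin (code L) , K , eq , U⊆K ∘ L⊆U , U⊆L ∘ K⊆U

  φ₀-finite : ∃[ b ] IsPhi n 0 r b
  φ₀-finite = finite⇒cardinality (multiplicativeSublattices n 0 r) _≈?_ enumerate enumerated

-- The bijection

image-pullback : ∀ {u v} {g : Growth u v} {L} → Classifies g L → member (image g (pullback g L)) ≐ member L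
image-pullback {g = g} {L} C =
    (λ { (x , x∈ , y≗) → ∈-resp-≈ L (λ i → sym (y≗ i)) x∈ })
  , (λ {y} y∈ → let y-constant = Classifies.constant C y∈ in
      restrict g y , ∈-resp-≈ L (λ i → sym (embed-restrict g y-constant i)) y∈ , λ i → sym (embed-restrict g y-constant i))

-- Multiplicative closure makes the number of classes equal to the rank. For the span of (1,2) in
-- ℤ^2, which is not closed, there are two classes but the rank is 1.
classification-corank : ∀ {n k} {L : Sublattice (n + k)} → IsMultiplicativelyClosed L → HasCorank L k →
                        Σ[ g ∈ Growth (n + k) n ] Classifies g L
classification-corank {n} {k} {L} *-closed (m , rank , m+k≡n+k) = subst-classification (classification L rank)
  where
  subst-classification : ∃[ v ] Σ[ g ∈ Growth (n + k) v ] Classifies g L → Σ[ g ∈ Growth (n + k) n ] Classifies g L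
  subst-classification (v , g , C) = subst (λ v → Σ[ g ∈ Growth (n + k) v ] Classifies g L)
    (trans (rank-unique L (classifies⇒rank g C *-closed) rank) (ℕ.+-cancelʳ-≡ k m n m+k≡n+k)) (g , C)

module _ {n k r : ℕ} where
  private
    Lattice = MultiplicativeSublattice (n + k) k r
    Lattice₀ = MultiplicativeSublattice n 0 r
    open Setoid (multiplicativeSublattices (n + k) k r) using ()
      renaming (_≈_ to _≈ₗ_; trans to ≈ₗ-trans; sym to ≈ₗ-sym)
    open Setoid (multiplicativeSublattices n 0 r) using () renaming (_≈_ to _≈₀_)

  blocks : (L : Lattice) → Σ[ g ∈ Growth (n + k) n ] Classifies g (sublattice L)
  blocks L = classification-corank (*-closed L) (corank L)

  contract : (L : Lattice) (g : Growth (n + k) n) → Classifies g (sublattice L) → Lattice₀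
  contract L g C = record
    { sublattice  = pullback g (sublattice L)
    ; *-closed    = pullback-*-closed g (sublattice L) (*-closed L)
    ; corank      = rank⇒corank0 {L = pullback g (sublattice L)}
                      (fullRank⇒rank (pullback g (sublattice L)) (pullback-fullRank g C (*-closed L)))
    ; torsionCard = Inverseₚ.trans
                      (Inverseₚ.sym (torsion-restricts g (classifies⇒restricts g C (*-closed L))))
                      (torsionCard L)
    }

  expand : Growth (n + k) n → Lattice₀ → Lattice
  expand g M = record
    { sublattice  = image g (sublattice M)
    ; *-closed    = image-*-closed g (sublattice M) (*-closed M)
    ; corank      = n , restricts-rank g {image g (sublattice M)} {sublattice M} (image-restricts g (sublattice M))
                          (corank0⇒rank {L = sublattice M} (corank M)) , refl
    ; torsionCard = Inverseₚ.trans (torsion-restricts g (image-restricts g (sublattice M))) (torsionCard M)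
    }

  expand-classifies : ∀ g M → Classifies g (sublattice (expand g M))
  expand-classifies g M = fullRank⇒classifies g (image-restricts g (sublattice M))
    (rank⇒fullRank (sublattice M) (corank0⇒rank {L = sublattice M} (corank M)))

  expand-cong : ∀ g M N → M ≈₀ N → expand g M ≈ₗ expand g N
  expand-cong g M N (M⊆N , N⊆M) =
    (λ { (x , x∈ , y≗) → x , M⊆N x∈ , y≗ }) , (λ { (x , x∈ , y≗) → x , N⊆M x∈ , y≗ })

  -- L has the elements of `expand g M`, which g classifies, so uniqueness gives h = g. After that
  -- `embed` matches the pullback with M.
  contract-expand : ∀ L h C g M → L ≈ₗ expand g M → h ≡ g × contract L h C ≈₀ M
  contract-expand L h C g M L≈ = h≡g , contract≈ h h≡g C
    where
    h≡g : h ≡ g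
    h≡g = classifies-unique {L = sublattice L} C (classifies-resp-≐ {L = sublattice (expand g M)} {sublattice L}
            (proj₂ L≈ , proj₁ L≈) (expand-classifies g M))
    open Restricts (image-restricts g (sublattice M))
    contract≈ : ∀ h → h ≡ g → (C : Classifies h (sublattice L)) → contract L h C ≈₀ M
    contract≈ h refl C = embed-∈⁻ ∘ proj₁ L≈ , proj₂ L≈ ∘ embed-∈

  expand-contract : ∀ L g C → expand g (contract L g C) ≈ₗ L
  expand-contract L g C = image-pullback {L = sublattice L} C

  decomposition : Inverse (multiplicativeSublattices (n + k) k r)
                          (≡.setoid (Growth (n + k) n) ×ₛ multiplicativeSublattices n 0 r)
  decomposition = record
    { to        = to
    ; from      = λ gM → expand (proj₁ gM) (proj₂ gM)
    -- Congruence reduces to the inverse law: K is the expansion of its own data, hence so is L.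
    ; to-cong   = λ {L} {K} L≈K → to-expand L _ (proj₂ (to K))
        (≈ₗ-trans {L} {K} {expand (proj₁ (blocks K)) (proj₂ (to K))} L≈K
          (≈ₗ-sym {expand (proj₁ (blocks K)) (proj₂ (to K))} {K} (from-to K)))
    ; from-cong = λ { {g , M} {_ , N} (refl , M≈N) → expand-cong g M N M≈N }
    ; inverse   = (λ { {g , M} {L} L≈ → to-expand L g M L≈ })
                , λ { {L} {g , M} (refl , M≈) → ≈ₗ-trans {expand g M} {expand g (proj₂ (to L))} {L}
                        (expand-cong g M (proj₂ (to L)) M≈) (from-to L) }
    }
    where
    to : Lattice → Growth (n + k) n × Lattice₀
    to L = proj₁ (blocks L) , contract L (proj₁ (blocks L)) (proj₂ (blocks L))

    to-expand : ∀ L g M → L ≈ₗ expand g M → proj₁ (to L) ≡ g × proj₂ (to L) ≈₀ M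
    to-expand L g M L≈ = contract-expand L (proj₁ (blocks L)) (proj₂ (blocks L)) g M L≈

    from-to : ∀ L → expand (proj₁ (to L)) (proj₂ (to L)) ≈ₗ L
    from-to L = expand-contract L (proj₁ (blocks L)) (proj₂ (blocks L))

theorem2 : ∀ (n k r : ℕ) → r ≥ 1 →
    ∃[ a ] ∃[ s ] ∃[ b ]
    IsPhi (n + k) k r a ×
    IsStirling (n + k + 1) (n + 1) s ×
    IsPhi n 0 r b ×
    a ≡ s * b
theorem2 n k r _ =
  let s , growths = Growth-cardinality (n + k) n
      b , φ₀ = φ₀-finite n r
  in s * b , s , b ,
     Inverseₚ.trans decomposition (Inverseₚ.trans (growths ×-inverse φ₀)
       (Inverseₚ.trans Pointwise-≡↔≡ (Inverseₚ.sym Fin.*↔×))) ,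
     subst₂ (λ p q → IsStirling p q s) (ℕ.+-comm 1 (n + k)) (ℕ.+-comm 1 n)
       (Inverseₚ.trans partitions-Growth growths) ,
     φ₀ , refl
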